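{- For every integer $n\ge 6$, $$ex_{\mathcal{OP}}(n,S_{2,2})=\begin{cases}\left\lfloor\frac{3(n-1)}{2}\right\rfloor, & \text{if } n\neq 10,\\ 14, & \text{if } n=10.\end{cases}$$
   Context: All graphs are finite, simple and undirected. For integers $q\ge p\ge 1$, the double star $S_{p,q}$ is the graph obtained from an edge $xy$ by joining $x$ to $p$ new vertices and $y$ to $q$ further new vertices. A graph is $H$-free if it contains no subgraph isomorphic to $H$. A graph is outerplanar if it has a planar embedding with all vertices on the boundary of the outer face. $ex_{\mathcal{OP}}(n,H)$ denotes the maximum number of edges of an $H$-free outerplanar graph on $n$ vertices (not necessarily connected). -}

module Defs where

open import Data.Nat using (ℕ; zero; suc; _+_; _*_; _<_; _≤_; _≥_; _≡ᵇ_; _<ᵇ_; _/_)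
open import Data.Bool using (Bool; true; false; if_then_else_; _∧_)
open import Data.Fin using (Fin; toℕ)
open import Data.List using (List; map; allFin)
open import Data.Nat.ListAction using (sum)
open import Data.Product using (Σ; _×_; ∃)
open import Data.Empty using (⊥)
open import Relation.Binary.PropositionalEquality using (_≡_)
open import Function.Definitions using (Injective)

record Graph (n : ℕ) : Set where
  field
    adj   : Fin n → Fin n → Bool
    sym   : ∀ u v → adj u v ≡ adj v u
    irrefl : ∀ u → adj u u ≡ false
open Graph public

edgeCount : ∀ {n} → Graph n → ℕ
edgeCount {n} G =
  sum (map (λ i → sum (map (λ j →
         if (toℕ i <ᵇ toℕ j) ∧ adj G i j then 1 else 0)
       (allFin n))) (allFin n))

-- Outerplanar: the vertices can be placed on a circle (in the cyclic order given
-- by an injective position map pos : Fin n → Fin n) so that the edges, drawn as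
-- straight chords, pairwise do not cross; i.e. there are no edges uv, wz with
-- pos u < pos w < pos v < pos z.
Outerplanar : ∀ {n} → Graph n → Set
Outerplanar {n} G =
  Σ (Fin n → Fin n) λ pos → Injective _≡_ _≡_ pos ×
    (∀ u v w z → adj G u v ≡ true → adj G w z ≡ true →
       toℕ (pos u) < toℕ (pos w) → toℕ (pos w) < toℕ (pos v) →
       toℕ (pos v) < toℕ (pos z) → ⊥)

_⊆G_ : ∀ {m n} → Graph m → Graph n → Set
_⊆G_ {m} {n} H G =
  Σ (Fin m → Fin n) λ f → Injective _≡_ _≡_ f ×
    (∀ u v → adj H u v ≡ true → adj G (f u) (f v) ≡ true)

-- The double star S_{2,2}: edge xy (x = 0, y = 1), x joined to 2,3 and y to 4,5.
s22adj : ℕ → ℕ → Bool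
s22adj 0 1 = true
s22adj 0 2 = true
s22adj 0 3 = true
s22adj 1 4 = true
s22adj 1 5 = true
s22adj 1 0 = true
s22adj 2 0 = true
s22adj 3 0 = true
s22adj 4 1 = true
s22adj 5 1 = true
s22adj _ _ = false

S22 : Graph 6
S22 = record
  { adj = λ u v → s22adj (toℕ u) (toℕ v)
  ; sym = symP
  ; irrefl = irr }
  where
  open import Data.Fin.Patterns
  symP : ∀ u v → s22adj (toℕ u) (toℕ v) ≡ s22adj (toℕ v) (toℕ u)
  symP 0F 0F = _≡_.refl
  symP 0F 1F = _≡_.refl
  symP 0F 2F = _≡_.refl
  symP 0F 3F = _≡_.refl
  symP 0F 4F = _≡_.refl
  symP 0F 5F = _≡_.refl
  symP 1F 0F = _≡_.refl
  symP 1F 1F = _≡_.refl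
  symP 1F 2F = _≡_.refl
  symP 1F 3F = _≡_.refl
  symP 1F 4F = _≡_.refl
  symP 1F 5F = _≡_.refl
  symP 2F 0F = _≡_.refl
  symP 2F 1F = _≡_.refl
  symP 2F 2F = _≡_.refl
  symP 2F 3F = _≡_.refl
  symP 2F 4F = _≡_.refl
  symP 2F 5F = _≡_.refl
  symP 3F 0F = _≡_.refl
  symP 3F 1F = _≡_.refl
  symP 3F 2F = _≡_.refl
  symP 3F 3F = _≡_.refl
  symP 3F 4F = _≡_.refl
  symP 3F 5F = _≡_.refl
  symP 4F 0F = _≡_.refl
  symP 4F 1F = _≡_.refl
  symP 4F 2F = _≡_.refl
  symP 4F 3F = _≡_.refl
  symP 4F 4F = _≡_.refl
  symP 4F 5F = _≡_.refl
  symP 5F 0F = _≡_.refl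
  symP 5F 1F = _≡_.refl
  symP 5F 2F = _≡_.refl
  symP 5F 3F = _≡_.refl
  symP 5F 4F = _≡_.refl
  symP 5F 5F = _≡_.refl
  irr : ∀ u → s22adj (toℕ u) (toℕ u) ≡ false
  irr 0F = _≡_.refl
  irr 1F = _≡_.refl
  irr 2F = _≡_.refl
  irr 3F = _≡_.refl
  irr 4F = _≡_.refl
  irr 5F = _≡_.refl

Free : ∀ {m n} → Graph m → Graph n → Set
Free H G = H ⊆G G → ⊥

OPFree : ∀ {m} → Graph m → (n : ℕ) → Graph n → Set
OPFree H n G = Outerplanar G × Free H G

ExOPIs : ∀ {m} → ℕ → Graph m → ℕ → Set
ExOPIs n H k =
  (Σ (Graph n) λ G → OPFree H n G × edgeCount G ≡ k) ×
  (∀ (G : Graph n) → OPFree H n G → edgeCount G ≤ k)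

exS22 : ℕ → ℕ
exS22 n = if n ≡ᵇ 10 then 14 else (3 * (n Data.Nat.∸ 1)) / 2

{-# OPTIONS --safe #-}
module Submission where

-- Upper bound, by deficiencies 3|S| − 2e(S) of induced subgraphs. The innermost edge spanning another
-- vertex yields a vertex of degree at most one, two adjacent vertices of degree at most two, or a
-- triangle with a vertex of degree two. In the last case S₂,₂-freeness puts the triangle in one of
-- few local configurations, and deleting it never increases the deficiency. Hence the deficiency is
-- at least 3 unless S is empty, a diamond K₄⁻ (deficiency 2), or contains a fan K₁ ∨ P₄. A fan cannot
-- be attached to anything and contributes only 1, so two disjoint fans account for n = 10.
-- Lower bound: friendship graphs, and two disjoint fans for n = 10.

open import Defs
open import Data.Bool using (Bool; true; false; T; if_then_else_; _∧_)
open import Data.Bool.Properties using () renaming (_≟_ to _≟ᵇ_)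
open import Data.Empty using (⊥; ⊥-elim)
open import Data.Fin using (Fin; toℕ; zero; suc; fromℕ<)
open import Data.Fin.Patterns
open import Data.Fin.Properties using (toℕ-injective; toℕ-fromℕ<; all?; pigeonhole) renaming (_≟_ to _≟ᶠ_; <⇒≢ to <⇒≢ᶠ)
open import Data.List using (List; []; _∷_; _++_; length; map; allFin; tabulate)
import Data.List.Membership.DecPropositional as DecMembership
open import Data.List.Membership.Propositional using (_∈_; _∉_)
open import Data.List.Membership.Propositional.Properties using (∈-∃++; ∈-++⁺ʳ; ∈-++⁻)
open import Data.List.Properties using (length-++; length-tabulate)
open import Data.List.Relation.Binary.Permutation.Propositional using (_↭_; refl; prep; swap; trans; ↭-sym; ↭-trans; ↭⇒↭ₛ)
open import Data.List.Relation.Binary.Permutation.Propositional.Properties using (∈-resp-↭; ↭-length; shift)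
import Data.List.Relation.Binary.Permutation.Setoid.Properties as Permutationₛ
open import Data.List.Relation.Unary.All as All using (All; []; _∷_)
open import Data.List.Relation.Unary.All.Properties using (¬Any⇒All¬; All¬⇒¬Any)
open import Data.List.Relation.Unary.AllPairs using ([]; _∷_)
open import Data.List.Relation.Unary.Any using (here; there)
open import Data.List.Relation.Unary.Unique.Propositional using (Unique)
open import Data.List.Relation.Unary.Unique.Propositional.Properties using (Unique[x∷xs]⇒x∉xs; allFin⁺)
open import Data.Nat using (ℕ; zero; suc; _+_; _*_; _<_; _≤_; _≥_; z≤n; s≤s; _<ᵇ_; _≡ᵇ_; _/_; _%_)
open import Data.Nat.DivMod using (m≡m%n+[m/n]*n; m%n<n; m*n/n≡m; /-monoˡ-≤; m/n≡1+[m∸n]/n; +-distrib-/-∣ˡ)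
open import Data.Nat.Divisibility using (n∣m*n)
open import Data.Nat.ListAction using (sum)
open import Data.Nat.Properties
open import Data.Nat.Tactic.RingSolver using (solve-∀)
open import Data.Product using (Σ; ∃; ∃₂; _×_; _,_; proj₂)
open import Data.Sum using (_⊎_; inj₁; inj₂)
open import Data.Vec using (Vec; lookup; []; _∷_)
import Data.Vec.Relation.Unary.All as V
import Data.Vec.Relation.Unary.AllPairs as V
open import Data.Vec.Relation.Unary.Unique.Propositional using () renaming (Unique to UniqueVec)
open import Data.Vec.Relation.Unary.Unique.Propositional.Properties using (lookup-injective)
open import Function using (_∘_; id)
open import Function.Definitions using (Injective)
open import Relation.Binary.Definitions using (tri<; tri≈; tri>)
open import Relation.Binary.PropositionalEquality using (_≡_; _≢_; cong; cong₂; subst; subst₂; setoid; ≢-sym; module ≡-Reasoning) renaming (refl to ≡-refl; sym to ≡-sym; trans to ≡-trans)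
open import Relation.Nullary using (¬_; Dec; yes; no)
open import Relation.Nullary.Decidable using (from-yes; _→-dec_; _×-dec_; ¬?)

-- A graph on `n` vertices has at most `⌊3(n−1)/2⌋` edges exactly when its deficiency is at least 3.
-- Numerical induction alone cannot reach 3: two adjacent vertices of degree two may carry three
-- edges, so deleting them gains nothing, and a remainder of deficiency 2 would leave the whole at
-- 2. The induction therefore records what the remainder is. If it is a diamond, the diamond itself
-- is kept, because the missing gain comes from showing that such a pair cannot be attached to it at
-- both ends. If it contains a fan, nothing is counted yet: a fan is a component of the whole graph,
-- so it is passed upwards through every step and split off only at the end. The rest after
-- splitting off a fan is arbitrary and may contain further fans, which is why the final bound
-- depends on the number of vertices. Vertex sets are duplicate-free lists, and a deletion is a
-- permutation followed by dropping a prefix. The graph, its circular order and its S₂,₂-freeness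
-- thus stay fixed throughout.

Unique-resp-↭ : ∀ {A : Set} {xs ys : List A} → xs ↭ ys → Unique xs → Unique ys
Unique-resp-↭ {A} σ = Permutationₛ.Unique-resp-↭ (setoid A) (↭⇒↭ₛ σ)

∈-↭ : ∀ {A : Set} {x : A} {xs} → x ∈ xs → ∃ λ ys → xs ↭ x ∷ ys
∈-↭ {x = x} x∈xs with ∈-∃++ x∈xs
... | ys , zs , ≡-refl = ys ++ zs , shift x ys zs

-- This is how vertices are deleted: the chosen ones are moved to the front, and `ys` is what
-- remains.
extract : ∀ {A : Set} {ls xs : List A} → Unique ls → All (_∈ xs) ls → ∃ λ ys → xs ↭ ls ++ ys
extract {xs = xs} [] [] = xs , refl
extract {ls = l ∷ ls} (l≢ ∷ u) (l∈xs ∷ ls⊆xs) with ∈-↭ l∈xs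
... | xs′ , σ with extract u (shrink l≢ ls⊆xs)
  where
  shrink : ∀ {ls} → All (l ≢_) ls → All (_∈ _) ls → All (_∈ xs′) ls
  shrink [] [] = []
  shrink (l≢m ∷ l≢) (m∈ ∷ ls⊆) with ∈-resp-↭ σ m∈
  ... | here m≡l = ⊥-elim (l≢m (≡-sym m≡l))
  ... | there m∈′ = m∈′ ∷ shrink l≢ ls⊆
... | ys , τ = ys , ↭-trans σ (prep l τ)

[_] : Bool → ℕ
[ b ] = if b then 1 else 0

-- Degrees and edge counts in lists of vertices

module Count {A : Set} (_~?_ : A → A → Bool) where

  deg : A → List A → ℕ
  deg x [] = 0
  deg x (y ∷ ys) = [ x ~? y ] + deg x ys

  edges : List A → ℕ
  edges [] = 0
  edges (x ∷ xs) = deg x xs + edges xs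

  deg-↭ : ∀ x {xs ys} → xs ↭ ys → deg x xs ≡ deg x ys
  deg-↭ x refl = ≡-refl
  deg-↭ x (prep y σ) = cong ([ x ~? y ] +_) (deg-↭ x σ)
  deg-↭ x (swap {xs} {ys} y z σ) = begin
    [ x ~? y ] + ([ x ~? z ] + deg x xs) ≡⟨ exchange [ x ~? y ] [ x ~? z ] _ ⟩
    [ x ~? z ] + ([ x ~? y ] + deg x xs) ≡⟨ cong (λ k → [ x ~? z ] + ([ x ~? y ] + k)) (deg-↭ x σ) ⟩
    [ x ~? z ] + ([ x ~? y ] + deg x ys) ∎
    where
    open ≡-Reasoning
    exchange : ∀ a b c → a + (b + c) ≡ b + (a + c)
    exchange = solve-∀
  deg-↭ x (trans σ τ) = ≡-trans (deg-↭ x σ) (deg-↭ x τ)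

  -- Each neighbour found in `xs` uses up one entry of `ls`, and `Unique xs` ensures that it is not
  -- asked for again. The list `ls` may contain repetitions.
  deg≤ : ∀ {x xs ls} → Unique xs → (∀ {y} → y ∈ xs → x ~? y ≡ true → y ∈ ls) → deg x xs ≤ length ls
  deg≤ [] _ = z≤n
  deg≤ {x} {y ∷ xs} {ls} (y≢ ∷ u) sub with x ~? y in x~y
  ... | false = deg≤ u (λ z∈ → sub (there z∈))
  ... | true with ∈-↭ (sub (here ≡-refl) x~y)
  ...   | ls′ , σ = subst (suc (deg x xs) ≤_) (≡-sym (↭-length σ)) (s≤s (deg≤ u sub′))
    where
    sub′ : ∀ {z} → z ∈ xs → x ~? z ≡ true → z ∈ ls′
    sub′ z∈ x~z with ∈-resp-↭ σ (sub (there z∈) x~z)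
    ... | here ≡-refl = ⊥-elim (Unique[x∷xs]⇒x∉xs (y≢ ∷ u) z∈)
    ... | there z∈′ = z∈′

  module _ (~-sym : ∀ x y → x ~? y ≡ y ~? x) where

    edges-↭ : ∀ {xs ys} → xs ↭ ys → edges xs ≡ edges ys
    edges-↭ refl = ≡-refl
    edges-↭ (prep x σ) = cong₂ _+_ (deg-↭ x σ) (edges-↭ σ)
    edges-↭ (swap {xs} {ys} x y σ) = begin
      [ x ~? y ] + deg x xs + (deg y xs + edges xs) ≡⟨ cong (λ b → [ b ] + deg x xs + (deg y xs + edges xs)) (~-sym x y) ⟩
      [ y ~? x ] + deg x xs + (deg y xs + edges xs) ≡⟨ exchange [ y ~? x ] (deg x xs) _ _ ⟩
      [ y ~? x ] + deg y xs + (deg x xs + edges xs) ≡⟨ cong₂ (λ k l → [ y ~? x ] + k + l) (deg-↭ y σ) (cong₂ _+_ (deg-↭ x σ) (edges-↭ σ)) ⟩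
      [ y ~? x ] + deg y ys + (deg x ys + edges ys) ∎
      where
      open ≡-Reasoning
      exchange : ∀ a b c d → a + b + (c + d) ≡ a + c + (b + d)
      exchange = solve-∀
    edges-↭ (trans σ τ) = ≡-trans (edges-↭ σ) (edges-↭ τ)

-- Agreement with `edgeCount`

Σ[_] : ∀ {A : Set} → List A → (A → ℕ) → ℕ
Σ[ xs ] f = sum (map f xs)

Σ-distrib-+ : ∀ {A : Set} xs (f g : A → ℕ) → Σ[ xs ] (λ x → f x + g x) ≡ Σ[ xs ] f + Σ[ xs ] g
Σ-distrib-+ [] f g = ≡-refl
Σ-distrib-+ (x ∷ xs) f g = ≡-trans (cong (f x + g x +_) (Σ-distrib-+ xs f g)) (exchange (f x) (g x) _ _)
  where
  exchange : ∀ a b c d → a + b + (c + d) ≡ a + c + (b + d)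
  exchange = solve-∀

module _ {n} (G : Graph n) where
  open Count (adj G)

  private
    edge : Fin n → Fin n → ℕ
    edge i j = [ (toℕ i <ᵇ toℕ j) ∧ adj G i j ]

    <ᵇ-irrefl : ∀ k → (k <ᵇ k) ≡ false
    <ᵇ-irrefl zero = ≡-refl
    <ᵇ-irrefl (suc k) = <ᵇ-irrefl k

    <ᵇ-total : ∀ k l → k ≢ l → ∀ b → [ (k <ᵇ l) ∧ b ] + [ (l <ᵇ k) ∧ b ] ≡ [ b ]
    <ᵇ-total zero zero k≢l b = ⊥-elim (k≢l ≡-refl)
    <ᵇ-total zero (suc l) _ b = +-identityʳ _
    <ᵇ-total (suc k) zero _ b = ≡-refl
    <ᵇ-total (suc k) (suc l) k≢l b = <ᵇ-total k l (k≢l ∘ cong suc) b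

    edge-self : ∀ i → edge i i ≡ 0
    edge-self i rewrite <ᵇ-irrefl (toℕ i) = ≡-refl

    edge-both : ∀ i j → edge i j + edge j i ≡ [ adj G i j ]
    edge-both i j with i ≟ᶠ j
    ... | yes ≡-refl rewrite edge-self i | irrefl G i = ≡-refl
    ... | no i≢j rewrite sym G j i = <ᵇ-total (toℕ i) (toℕ j) (i≢j ∘ toℕ-injective) (adj G i j)

    Σ-deg : ∀ i xs → Σ[ xs ] (edge i) + Σ[ xs ] (λ j → edge j i) ≡ deg i xs
    Σ-deg i xs = ≡-trans (≡-sym (Σ-distrib-+ xs (edge i) _)) (go xs)
      where
      go : ∀ xs → Σ[ xs ] (λ j → edge i j + edge j i) ≡ deg i xs
      go [] = ≡-refl
      go (x ∷ xs) = cong₂ _+_ (edge-both i x) (go xs)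

    -- Peeling off `x` from the square of pairs leaves its row and its column. Together they give
    -- its degree, since of two distinct indices exactly one is the smaller.
    Σ-edges : ∀ xs → Σ[ xs ] (λ i → Σ[ xs ] (edge i)) ≡ edges xs
    Σ-edges [] = ≡-refl
    Σ-edges (x ∷ xs) = begin
      edge x x + Σ[ xs ] (edge x) + Σ[ xs ] (λ i → edge i x + Σ[ xs ] (edge i))
        ≡⟨ cong₂ (λ k l → k + Σ[ xs ] (edge x) + l) (edge-self x) (Σ-distrib-+ xs _ _) ⟩
      Σ[ xs ] (edge x) + (Σ[ xs ] (λ i → edge i x) + Σ[ xs ] (λ i → Σ[ xs ] (edge i)))
        ≡⟨ +-assoc (Σ[ xs ] (edge x)) _ _ ⟨
      Σ[ xs ] (edge x) + Σ[ xs ] (λ i → edge i x) + Σ[ xs ] (λ i → Σ[ xs ] (edge i))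
        ≡⟨ cong₂ _+_ (Σ-deg x xs) (Σ-edges xs) ⟩
      deg x xs + edges xs ∎
      where open ≡-Reasoning

  edgeCount≡edges : edgeCount G ≡ edges (allFin n)
  edgeCount≡edges = Σ-edges (allFin n)

Unique-++⁻ʳ : ∀ {A : Set} xs {ys : List A} → Unique (xs ++ ys) → Unique ys
Unique-++⁻ʳ [] u = u
Unique-++⁻ʳ (_ ∷ xs) (_ ∷ u) = Unique-++⁻ʳ xs u

++-disjoint : ∀ {A : Set} {x : A} xs {ys} → Unique (xs ++ ys) → x ∈ xs → x ∉ ys
++-disjoint (x ∷ xs) u (here ≡-refl) x∈ys = Unique[x∷xs]⇒x∉xs u (∈-++⁺ʳ xs x∈ys)
++-disjoint (x ∷ xs) (_ ∷ u) (there x∈xs) x∈ys = ++-disjoint xs u x∈xs x∈ys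

pattern i0 = here ≡-refl
pattern i1 = there i0
pattern i2 = there i1
pattern i3 = there i2
pattern i4 = there i3

-- Neighbourhoods inside a vertex list

module Neighbourhoods {n} (G : Graph n) where
  open Count (adj G) public

  infix 4 _~_
  _~_ : Fin n → Fin n → Set
  u ~ v = adj G u v ≡ true

  _~?_ : ∀ u v → Dec (u ~ v)
  u ~? v = adj G u v ≟ᵇ true

  ~-sym : ∀ {u v} → u ~ v → v ~ u
  ~-sym {u} {v} u~v = ≡-trans (sym G v u) u~v

  ~⇒≢ : ∀ {u v} → u ~ v → u ≢ v
  ~⇒≢ {u} u~u ≡-refl with ≡-trans (≡-sym u~u) (irrefl G u)
  ... | ()

  open DecMembership (_≟ᶠ_ {n}) public using (_∈?_)

  edges-resp-↭ : ∀ {S L k} → S ↭ L → edges L ≤ k → edges S ≤ k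
  edges-resp-↭ σ = subst (_≤ _) (≡-sym (edges-↭ (sym G) σ))

  -- Only an inclusion: entries of `M` may repeat or fail to be neighbours, so a two-entry `M` means
  -- degree at most two in `S`.
  NbrsIn : Fin n → List (Fin n) → List (Fin n) → Set
  NbrsIn v S M = ∀ {z} → z ∈ S → v ~ z → z ∈ M

  weaken : ∀ {v S M N} → NbrsIn v S M → All (_∈ N) M → NbrsIn v S N
  weaken nb M⊆N z∈S v~z = All.lookup M⊆N (nb z∈S v~z)

  -- Drives every case analysis below: applied with growing `D` it produces new neighbours one at a
  -- time, until one of them is contradictory.
  nbrsIn-or-other : ∀ v S D → NbrsIn v S D ⊎ ∃ λ z → z ∈ S × v ~ z × All (z ≢_) D
  nbrsIn-or-other v [] D = inj₁ λ ()
  nbrsIn-or-other v (s ∷ S) D with nbrsIn-or-other v S D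
  ... | inj₂ (z , z∈ , v~z , z∉) = inj₂ (z , there z∈ , v~z , z∉)
  ... | inj₁ nb with v ~? s | s ∈? D
  ...   | no v≁s | _ = inj₁ λ { i0 v~s → ⊥-elim (v≁s v~s) ; (there z∈) v~z → nb z∈ v~z }
  ...   | yes _ | yes s∈D = inj₁ λ { i0 _ → s∈D ; (there z∈) v~z → nb z∈ v~z }
  ...   | yes v~s | no s∉D = inj₂ (s , i0 , v~s , ¬Any⇒All¬ D s∉D)

  -- In `edges` every edge is counted at its earlier endpoint, so neighbours in `pre` are already
  -- accounted for and only the candidates in `L` can still contribute.
  deg-after : ∀ {v S T M} pre L → S ↭ pre ++ T → Unique S → NbrsIn v S M → All (_∈ pre ++ L) M → deg v T ≤ length L
  deg-after {v} {S} {T} {M} pre L σ u nb M⊆ = deg≤ (Unique-++⁻ʳ pre u′) sub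
    where
    u′ = Unique-resp-↭ σ u
    sub : ∀ {z} → z ∈ T → v ~ z → z ∈ L
    sub z∈T v~z with ∈-++⁻ pre (weaken nb M⊆ (∈-resp-↭ (↭-sym σ) (∈-++⁺ʳ pre z∈T)) v~z)
    ... | inj₁ z∈pre = ⊥-elim (++-disjoint pre u′ z∈pre z∈T)
    ... | inj₂ z∈L = z∈L

-- End configurations of a non-crossing graph

module EndConfiguration {n} (G : Graph n) (pos : Fin n → ℕ) (pos-injective : Injective _≡_ _≡_ pos)
  (noncrossing : ∀ u v w z → adj G u v ≡ true → adj G w z ≡ true → pos u < pos w → pos w < pos v → pos v < pos z → ⊥)
  where
  open Neighbourhoods G

  -- The vertices `l`, `p` and `q` may be mere placeholders, so smaller degrees are covered by the
  -- same constructors.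
  data Config (S : List (Fin n)) : Set where
    leaf : ∀ {v l} → v ∈ S → NbrsIn v S (l ∷ []) → Config S
    pair : ∀ {a b p q} → a ∈ S → b ∈ S → a ~ b → NbrsIn a S (b ∷ p ∷ []) → NbrsIn b S (a ∷ q ∷ []) → Config S
    ear  : ∀ {a x y} → a ∈ S → x ∈ S → y ∈ S → a ~ x → a ~ y → x ~ y → NbrsIn a S (x ∷ y ∷ []) → Config S

  Two : Fin n → List (Fin n) → Set
  Two v S = ∃₂ λ j k → j ∈ S × k ∈ S × v ~ j × v ~ k × j ≢ k

  one-or-two : ∀ v S → (∃ λ l → NbrsIn v S (l ∷ [])) ⊎ Two v S
  one-or-two v S with nbrsIn-or-other v S []
  ... | inj₁ nb = inj₁ (v , weaken nb [])
  ... | inj₂ (j , j∈ , v~j , _) with nbrsIn-or-other v S (j ∷ [])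
  ...   | inj₁ nb = inj₁ (j , nb)
  ...   | inj₂ (k , k∈ , v~k , k≢j ∷ []) = inj₂ (j , k , j∈ , k∈ , v~j , v~k , ≢-sym k≢j)

  leaf-or-two : ∀ {S} xs → All (_∈ S) xs → Config S ⊎ All (λ v → Two v S) xs
  leaf-or-two [] [] = inj₂ []
  leaf-or-two {S} (x ∷ xs) (x∈ ∷ xs⊆) with one-or-two x S | leaf-or-two xs xs⊆
  ... | inj₁ (_ , nb) | _ = inj₁ (leaf x∈ nb)
  ... | inj₂ _ | inj₁ c = inj₁ c
  ... | inj₂ t | inj₂ ts = inj₂ (t ∷ ts)

  module _ {S : List (Fin n)} (two : ∀ {v} → v ∈ S → Two v S) where

    record Arc (u v i : Fin n) : Set where
      constructor arc
      field
        u∈ : u ∈ S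
        v∈ : v ∈ S
        i∈ : i ∈ S
        u~v : u ~ v
        u<i : pos u < pos i
        i<v : pos i < pos v

    -- The bound on spans is phrased with fuel k to suit the recursion in descend.
    Shorter : Fin n → Fin n → Set
    Shorter u v = ∃₂ λ u′ v′ → ∃ λ i′ → Arc u′ v′ i′ × (∀ k → pos v ≤ suc k + pos u → pos v′ ≤ k + pos u′)

    record Through (u v i : Fin n) : Set where
      constructor through
      field
        {l r} : Fin n
        l∈ : l ∈ S
        r∈ : r ∈ S
        i~l : i ~ l
        i~r : i ~ r
        u≤l : pos u ≤ pos l
        l<i : pos l < pos i
        i<r : pos i < pos r
        r≤v : pos r ≤ pos v
        nbrs : NbrsIn i S (l ∷ r ∷ [])

    module _ {u v i} (α : Arc u v i) where
      open Arc α

      -- An edge from `i` leaving the interval between `u` and `v` would cross `uv`.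
      side : ∀ {j} → i ~ j → (pos u ≤ pos j × pos j < pos i) ⊎ (pos i < pos j × pos j ≤ pos v)
      side {j} i~j with <-cmp (pos j) (pos i)
      ... | tri< j<i _ _ = inj₁ (≮⇒≥ (λ j<u → noncrossing j i u v (~-sym i~j) u~v j<u u<i i<v) , j<i)
      ... | tri≈ _ j≡i _ = ⊥-elim (~⇒≢ i~j (≡-sym (pos-injective j≡i)))
      ... | tri> _ _ i<j = inj₂ (i<j , ≮⇒≥ (λ v<j → noncrossing u v i j u~v i~j u<i i<v v<j))

      shrink : ∀ {a} → a ≤ pos v → ∀ m → pos v ≤ suc m + pos u → a ≤ m + pos i
      shrink a≤v m v≤ = ≤-trans a≤v (≤-trans v≤ (≤-trans (≤-reflexive (≡-sym (+-suc m _))) (+-monoʳ-≤ m u<i)))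

      right-pair : ∀ {j k} → j ∈ S → k ∈ S → i ~ j → i ~ k → j ≢ k →
                   pos i < pos j × pos j ≤ pos v → pos i < pos k × pos k ≤ pos v → Shorter u v
      right-pair {j} {k} j∈ k∈ i~j i~k j≢k (i<j , j≤v) (i<k , k≤v) with <-cmp (pos j) (pos k)
      ... | tri< j<k _ _ = i , k , j , arc i∈ k∈ j∈ i~k i<j j<k , shrink k≤v
      ... | tri≈ _ j≡k _ = ⊥-elim (j≢k (pos-injective j≡k))
      ... | tri> _ _ k<j = i , j , k , arc i∈ j∈ k∈ i~j i<k k<j , shrink j≤v

      left-pair : ∀ {j k} → j ∈ S → k ∈ S → i ~ j → i ~ k → j ≢ k →
                  pos u ≤ pos j × pos j < pos i → pos u ≤ pos k × pos k < pos i → Shorter u v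
      left-pair {j} {k} j∈ k∈ i~j i~k j≢k (u≤j , j<i) (u≤k , k<i) with <-cmp (pos j) (pos k)
      ... | tri< j<k _ _ = j , i , k , arc j∈ i∈ k∈ (~-sym i~j) j<k k<i ,
                           λ m v≤ → ≤-trans (≤-pred (≤-trans i<v v≤)) (+-monoʳ-≤ m u≤j)
      ... | tri≈ _ j≡k _ = ⊥-elim (j≢k (pos-injective j≡k))
      ... | tri> _ _ k<j = k , i , j , arc k∈ i∈ j∈ (~-sym i~k) k<j j<i ,
                           λ m v≤ → ≤-trans (≤-pred (≤-trans i<v v≤)) (+-monoʳ-≤ m u≤k)

      left-right : ∀ {j k} → j ∈ S → k ∈ S → i ~ j → i ~ k →
                   pos u ≤ pos j × pos j < pos i → pos i < pos k × pos k ≤ pos v → Shorter u v ⊎ Through u v i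
      left-right {j} {k} j∈ k∈ i~j i~k (u≤j , j<i) (i<k , k≤v) with nbrsIn-or-other i S (j ∷ k ∷ [])
      ... | inj₁ nb = inj₂ (through j∈ k∈ i~j i~k u≤j j<i i<k k≤v nb)
      ... | inj₂ (m , m∈ , i~m , m≢j ∷ m≢k ∷ []) with side i~m
      ...   | inj₁ left = inj₁ (left-pair j∈ m∈ i~j i~m (≢-sym m≢j) (u≤j , j<i) left)
      ...   | inj₂ right = inj₁ (right-pair k∈ m∈ i~k i~m (≢-sym m≢k) (i<k , k≤v) right)

      -- Two neighbours of i on the same side of i give an edge at i spanning the nearer one; so
      -- otherwise i has exactly one neighbour on each side.
      shorter-or-through : Shorter u v ⊎ Through u v i
      shorter-or-through with two i∈
      ... | j , k , j∈ , k∈ , i~j , i~k , j≢k with side i~j | side i~k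
      ...   | inj₁ jl | inj₁ kl = inj₁ (left-pair j∈ k∈ i~j i~k j≢k jl kl)
      ...   | inj₁ jl | inj₂ kr = left-right j∈ k∈ i~j i~k jl kr
      ...   | inj₂ jr | inj₁ kl = left-right k∈ j∈ i~k i~j kl jr
      ...   | inj₂ jr | inj₂ kr = inj₁ (right-pair j∈ k∈ i~j i~k j≢k jr kr)

    put-first : ∀ {v w l r} → NbrsIn v S (l ∷ r ∷ []) → w ∈ l ∷ r ∷ [] → ∃ λ p → NbrsIn v S (w ∷ p ∷ [])
    put-first nb i0 = _ , nb
    put-first nb i1 = _ , weaken nb (i1 ∷ i0 ∷ [])

    -- The vertex `w` lies under the same arc as `i`, so it too gives a shorter arc or has degree
    -- two; in the latter case `i` and `w` form a pair.
    interior-pair : ∀ {u v i w} → Arc u v i → Through u v i → Arc u v w → i ~ w → Shorter u v ⊎ Config S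
    interior-pair α θ β i~w with shorter-or-through β
    ... | inj₁ s = inj₁ s
    ... | inj₂ η = inj₂ (pair (Arc.i∈ α) (Arc.i∈ β) i~w
                          (proj₂ (put-first (Through.nbrs θ) (Through.nbrs θ (Arc.i∈ β) i~w)))
                          (proj₂ (put-first (Through.nbrs η) (Through.nbrs η (Arc.i∈ α) (~-sym i~w)))))

    -- If `i` has just one neighbour on each side, either these are `u` and `v`, and `i` is an ear
    -- over `uv`, or one of them is strictly inside the arc and `interior-pair` applies.
    shorter-or-config : ∀ {u v i} → Arc u v i → Shorter u v ⊎ Config S
    shorter-or-config {u} {v} α@(arc u∈ v∈ i∈ u~v u<i i<v) with shorter-or-through α
    ... | inj₁ s = inj₁ s
    ... | inj₂ θ@(through {l} {r} l∈ r∈ i~l i~r u≤l l<i i<r r≤v nb) with l ≟ᶠ u | r ≟ᶠ v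
    ...   | yes ≡-refl | yes ≡-refl = inj₂ (ear i∈ l∈ r∈ i~l i~r u~v nb)
    ...   | no l≢u | _ = interior-pair α θ (arc u∈ v∈ l∈ u~v (≤∧≢⇒< u≤l (l≢u ∘ ≡-sym ∘ pos-injective)) (<-trans l<i i<v)) i~l
    ...   | yes _ | no r≢v = interior-pair α θ (arc u∈ v∈ r∈ u~v (<-trans u<i i<r) (≤∧≢⇒< r≤v (r≢v ∘ pos-injective))) i~r

    descend : ∀ k {u v i} → Arc u v i → pos v ≤ k + pos u → Config S
    descend zero (arc _ _ _ _ u<i i<v) v≤u = ⊥-elim (<⇒≱ (<-trans u<i i<v) v≤u)
    descend (suc k) α v≤ with shorter-or-config α
    ... | inj₁ (_ , _ , _ , β , shrink) = descend k β (shrink k v≤)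
    ... | inj₂ c = c

    -- Supplies the first arc: stepping to neighbours further left must stop, and at a vertex with
    -- two neighbours on its right the longer edge spans the nearer neighbour.
    leftmost : ∀ k {i} → i ∈ S → pos i ≤ k → Config S
    leftmost k {i} i∈ i≤k with two i∈
    ... | j , l , j∈ , l∈ , i~j , i~l , j≢l with <-cmp (pos j) (pos i) | <-cmp (pos l) (pos i)
    ...   | tri≈ _ j≡i _ | _ = ⊥-elim (~⇒≢ i~j (≡-sym (pos-injective j≡i)))
    ...   | _ | tri≈ _ l≡i _ = ⊥-elim (~⇒≢ i~l (≡-sym (pos-injective l≡i)))
    leftmost zero i∈ i≤0 | j , l , j∈ , l∈ , i~j , i~l , j≢l | tri< j<i _ _ | _ = ⊥-elim (n≮0 (≤-trans j<i i≤0))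
    leftmost (suc k) i∈ i≤k | j , l , j∈ , l∈ , i~j , i~l , j≢l | tri< j<i _ _ | _ = leftmost k j∈ (≤-pred (≤-trans j<i i≤k))
    leftmost zero i∈ i≤0 | j , l , j∈ , l∈ , i~j , i~l , j≢l | _ | tri< l<i _ _ = ⊥-elim (n≮0 (≤-trans l<i i≤0))
    leftmost (suc k) i∈ i≤k | j , l , j∈ , l∈ , i~j , i~l , j≢l | _ | tri< l<i _ _ = leftmost k l∈ (≤-pred (≤-trans l<i i≤k))
    leftmost k {i} i∈ i≤k | j , l , j∈ , l∈ , i~j , i~l , j≢l | tri> _ _ i<j | tri> _ _ i<l with <-cmp (pos j) (pos l)
    ... | tri< j<l _ _ = descend (pos l) (arc i∈ l∈ j∈ i~l i<j j<l) (m≤m+n _ _)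
    ... | tri≈ _ j≡l _ = ⊥-elim (j≢l (pos-injective j≡l))
    ... | tri> _ _ l<j = descend (pos j) (arc i∈ j∈ l∈ i~j i<l l<j) (m≤m+n _ _)

  config : ∀ {S v} → v ∈ S → Config S
  config {S} {v} v∈ with leaf-or-two S (All.tabulate id)
  ... | inj₁ c = c
  ... | inj₂ two = leftmost (All.lookup two) (pos v) v∈ ≤-refl

-- Separation by two points of the circle

module Separation {n} (G : Graph n) (pos : Fin n → ℕ) (pos-injective : Injective _≡_ _≡_ pos)
  (noncrossing : ∀ u v w z → adj G u v ≡ true → adj G w z ≡ true → pos u < pos w → pos w < pos v → pos v < pos z → ⊥)
  where
  open Neighbourhoods G

  module Sides {x y} (x<y : pos x < pos y) where

    data Side (c : Fin n) : Set where
      left   : pos c < pos x → Side c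
      inside : pos x < pos c → pos c < pos y → Side c
      right  : pos y < pos c → Side c

    side : ∀ {c} → c ≢ x → c ≢ y → Side c
    side {c} c≢x c≢y with <-cmp (pos c) (pos x) | <-cmp (pos c) (pos y)
    ... | tri< c<x _ _ | _ = left c<x
    ... | tri≈ _ c≡x _ | _ = ⊥-elim (c≢x (pos-injective c≡x))
    ... | tri> _ _ _ | tri≈ _ c≡y _ = ⊥-elim (c≢y (pos-injective c≡y))
    ... | tri> _ _ x<c | tri< c<y _ _ = inside x<c c<y
    ... | tri> _ _ _ | tri> _ _ y<c = right y<c

    -- The points `x` and `y` cut the circle into two arcs; `left` and `right` are the two ends of
    -- the same outer arc.
    isInside : ∀ {c} → Side c → Bool
    isInside (left _) = false
    isInside (inside _ _) = true
    isInside (right _) = false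

    Common : Fin n → Set
    Common c = x ~ c × y ~ c

    side-common : ∀ {c} → Common c → Side c
    side-common (x~c , y~c) = side (≢-sym (~⇒≢ x~c)) (≢-sym (~⇒≢ y~c))

    -- If both lay on the same arc, an edge from `x` to one of them would cross an edge from `y` to
    -- the other.
    ordered-opposite : ∀ {c d} → Common c → Common d → pos c < pos d → (σ : Side c) (τ : Side d) → isInside σ ≢ isInside τ
    ordered-opposite (x~c , y~c) (x~d , y~d) c<d (left c<x) (left d<x) _ = noncrossing _ _ _ _ (~-sym x~c) (~-sym y~d) c<d d<x x<y
    ordered-opposite (x~c , y~c) (x~d , y~d) c<d (left c<x) (right y<d) _ = noncrossing _ _ _ _ (~-sym y~c) x~d c<x x<y y<d
    ordered-opposite (x~c , y~c) (x~d , y~d) c<d (inside x<c c<y) (inside x<d d<y) _ = noncrossing _ _ _ _ x~d (~-sym y~c) x<c c<d d<y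
    ordered-opposite _ _ c<d (right y<c) (left d<x) _ = <-asym c<d (<-trans d<x (<-trans x<y y<c))
    ordered-opposite (x~c , y~c) (x~d , y~d) c<d (right y<c) (right y<d) _ = noncrossing _ _ _ _ x~c y~d x<y y<c c<d

    opposite : ∀ {c d} → Common c → Common d → c ≢ d → (σ : Side c) (τ : Side d) → isInside σ ≢ isInside τ
    opposite {c} {d} cc cd c≢d σ τ with <-cmp (pos c) (pos d)
    ... | tri< c<d _ _ = ordered-opposite cc cd c<d σ τ
    ... | tri≈ _ c≡d _ = ⊥-elim (c≢d (pos-injective c≡d))
    ... | tri> _ _ d<c = ordered-opposite cd cc d<c τ σ ∘ ≡-sym

    -- An edge between the two arcs would cross the chord `xy`.
    same-side : x ~ y → ∀ {a b} → a ~ b → (σ : Side a) (τ : Side b) → isInside σ ≡ isInside τ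
    same-side x~y a~b (inside x<a a<y) (left b<x) = ⊥-elim (noncrossing _ _ _ _ (~-sym a~b) x~y b<x x<a a<y)
    same-side x~y a~b (inside x<a a<y) (right y<b) = ⊥-elim (noncrossing _ _ _ _ x~y a~b x<a a<y y<b)
    same-side x~y a~b (left a<x) (inside x<b b<y) = ⊥-elim (noncrossing _ _ _ _ a~b x~y a<x x<b b<y)
    same-side x~y a~b (right y<a) (inside x<b b<y) = ⊥-elim (noncrossing _ _ _ _ x~y (~-sym a~b) x<b b<y y<a)
    same-side x~y a~b (inside _ _) (inside _ _) = ≡-refl
    same-side x~y a~b (left _) (left _) = ≡-refl
    same-side x~y a~b (left _) (right _) = ≡-refl
    same-side x~y a~b (right _) (left _) = ≡-refl
    same-side x~y a~b (right _) (right _) = ≡-refl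

    three-booleans : ∀ (a b c : Bool) → a ≢ b → b ≢ c → a ≢ c → ⊥
    three-booleans false false _ a≢b _ _ = a≢b ≡-refl
    three-booleans true true _ a≢b _ _ = a≢b ≡-refl
    three-booleans _ false false _ b≢c _ = b≢c ≡-refl
    three-booleans _ true true _ b≢c _ = b≢c ≡-refl
    three-booleans false _ false _ _ a≢c = a≢c ≡-refl
    three-booleans true _ true _ _ a≢c = a≢c ≡-refl

    no-K₂,₃-ordered : ∀ {c d e} → Common c → Common d → Common e → c ≢ d → d ≢ e → c ≢ e → ⊥
    no-K₂,₃-ordered cc cd ce c≢d d≢e c≢e = three-booleans _ _ _
      (opposite cc cd c≢d (side-common cc) (side-common cd))
      (opposite cd ce d≢e (side-common cd) (side-common ce))
      (opposite cc ce c≢e (side-common cc) (side-common ce))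

    no-detour-ordered : ∀ {s t a b} → x ~ y → Common s → Common t → s ≢ t → s ~ a → a ~ b → b ~ t →
                        a ≢ x → a ≢ y → b ≢ x → b ≢ y → ⊥
    no-detour-ordered x~y cs ct s≢t s~a a~b b~t a≢x a≢y b≢x b≢y =
      opposite cs ct s≢t (side-common cs) (side-common ct)
        (≡-trans (same-side x~y s~a (side-common cs) (side a≢x a≢y))
        (≡-trans (same-side x~y a~b (side a≢x a≢y) (side b≢x b≢y))
                 (same-side x~y b~t (side b≢x b≢y) (side-common ct))))

  -- Each of the two arcs between `x` and `y` holds at most one common neighbour.
  no-K₂,₃ : ∀ {x y c d e} → x ≢ y → x ~ c → y ~ c → x ~ d → y ~ d → x ~ e → y ~ e → c ≢ d → d ≢ e → c ≢ e → ⊥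
  no-K₂,₃ {x} {y} x≢y xc yc xd yd xe ye with <-cmp (pos x) (pos y)
  ... | tri< x<y _ _ = Sides.no-K₂,₃-ordered x<y (xc , yc) (xd , yd) (xe , ye)
  ... | tri≈ _ x≡y _ = ⊥-elim (x≢y (pos-injective x≡y))
  ... | tri> _ _ y<x = Sides.no-K₂,₃-ordered y<x (yc , xc) (yd , xd) (ye , xe)

  -- The common neighbours `s` and `t` lie on opposite arcs, while a path avoiding `x` and `y`
  -- cannot cross the chord `xy`. This excludes the one attachment to a diamond for which planarity
  -- is used instead of an S₂,₂.
  no-detour : ∀ {x y s t a b} → x ~ y → x ~ s → y ~ s → x ~ t → y ~ t → s ≢ t → s ~ a → a ~ b → b ~ t →
              a ≢ x → a ≢ y → b ≢ x → b ≢ y → ⊥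
  no-detour {x} {y} x~y xs ys xt yt s≢t sa ab bt a≢x a≢y b≢x b≢y with <-cmp (pos x) (pos y)
  ... | tri< x<y _ _ = Sides.no-detour-ordered x<y x~y (xs , ys) (xt , yt) s≢t sa ab bt a≢x a≢y b≢x b≢y
  ... | tri≈ _ x≡y _ = ⊥-elim (~⇒≢ x~y (pos-injective x≡y))
  ... | tri> _ _ y<x = Sides.no-detour-ordered y<x (~-sym x~y) (ys , xs) (yt , xt) s≢t sa ab bt a≢y a≢x b≢y b≢x

-- Consequences of S₂,₂-freeness, and fans

module DoubleStar {n} (G : Graph n) (free : Free S22 G) where
  open Neighbourhoods G

  no-S₂,₂ : ∀ {x y p q r s} → x ~ y → x ~ p → x ~ q → y ~ r → y ~ s →
            y ≢ p → y ≢ q → x ≢ r → x ≢ s → p ≢ q → r ≢ s → p ≢ r → p ≢ s → q ≢ r → q ≢ s → ⊥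
  no-S₂,₂ {x} {y} {p} {q} {r} {s} xy xp xq yr ys y≢p y≢q x≢r x≢s p≢q r≢s p≢r p≢s q≢r q≢s =
    free (lookup vs , lookup-injective distinct _ _ , edge)
    where
    vs : Vec (Fin n) 6
    vs = x ∷ y ∷ p ∷ q ∷ r ∷ s ∷ []
    distinct : UniqueVec vs
    distinct =
      (~⇒≢ xy V.∷ ~⇒≢ xp V.∷ ~⇒≢ xq V.∷ x≢r V.∷ x≢s V.∷ V.[]) V.∷
      (y≢p V.∷ y≢q V.∷ ~⇒≢ yr V.∷ ~⇒≢ ys V.∷ V.[]) V.∷
      (p≢q V.∷ p≢r V.∷ p≢s V.∷ V.[]) V.∷
      (q≢r V.∷ q≢s V.∷ V.[]) V.∷
      (r≢s V.∷ V.[]) V.∷ V.[] V.∷ V.[]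
    edge : ∀ i j → adj S22 i j ≡ true → adj G (lookup vs i) (lookup vs j) ≡ true
    edge 0F 1F _ = xy
    edge 0F 2F _ = xp
    edge 0F 3F _ = xq
    edge 1F 4F _ = yr
    edge 1F 5F _ = ys
    edge 1F 0F _ = ~-sym xy
    edge 2F 0F _ = ~-sym xp
    edge 3F 0F _ = ~-sym xq
    edge 4F 1F _ = ~-sym yr
    edge 5F 1F _ = ~-sym ys

  -- Two further neighbours of `w` would differ from `p` and `q`, and `xw` would be the central edge
  -- of an S₂,₂.
  low-degree : ∀ {S x p q w} → w ~ x → x ~ p → x ~ q → p ≢ q → w ≢ p → w ≢ q → ¬ (w ~ p) → ¬ (w ~ q) →
               ∃ λ z → NbrsIn w S (x ∷ z ∷ [])
  low-degree {S} {x} {p} {q} {w} wx xp xq p≢q w≢p w≢q w≁p w≁q with nbrsIn-or-other w S (x ∷ [])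
  ... | inj₁ nb = x , weaken nb (i0 ∷ [])
  ... | inj₂ (z , _ , wz , z≢x ∷ []) with nbrsIn-or-other w S (x ∷ z ∷ [])
  ...   | inj₁ nb = z , nb
  ...   | inj₂ (z′ , _ , wz′ , z′≢x ∷ z′≢z ∷ []) = ⊥-elim (no-S₂,₂ (~-sym wx) xp xq wz wz′
            w≢p w≢q (≢-sym z≢x) (≢-sym z′≢x) p≢q (≢-sym z′≢z) (avoid w≁p wz) (avoid w≁p wz′) (avoid w≁q wz) (avoid w≁q wz′))
    where
    avoid : ∀ {a b} → ¬ (w ~ a) → w ~ b → a ≢ b
    avoid w≁a w~b ≡-refl = w≁a w~b

  -- No restriction to S in the neighbourhoods: a fan is a whole component of G, so it stays one in every
  -- larger vertex set.
  record Fan (S : List (Fin n)) : Set where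
    field
      {c p₁ p₂ p₃ p₄} : Fin n
    vertices : List (Fin n)
    vertices = c ∷ p₁ ∷ p₂ ∷ p₃ ∷ p₄ ∷ []
    field
      vertices⊆S : All (_∈ S) vertices
      distinct : Unique vertices
      nbrs-c  : ∀ {z} → c ~ z → z ∈ p₁ ∷ p₂ ∷ p₃ ∷ p₄ ∷ []
      nbrs-p₁ : ∀ {z} → p₁ ~ z → z ∈ c ∷ p₂ ∷ []
      nbrs-p₂ : ∀ {z} → p₂ ~ z → z ∈ c ∷ p₁ ∷ p₃ ∷ []
      nbrs-p₃ : ∀ {z} → p₃ ~ z → z ∈ c ∷ p₂ ∷ p₄ ∷ []
      nbrs-p₄ : ∀ {z} → p₄ ~ z → z ∈ c ∷ p₃ ∷ []

  -- Passes from neighbourhoods in `S` to neighbourhoods in `G`: an edge from any of the five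
  -- vertices to an outside `z` completes an S₂,₂ whose central edge joins the hub `c` to a path
  -- vertex.
  mkFan : ∀ {S c p₁ p₂ p₃ p₄} → All (_∈ S) (c ∷ p₁ ∷ p₂ ∷ p₃ ∷ p₄ ∷ []) → Unique (c ∷ p₁ ∷ p₂ ∷ p₃ ∷ p₄ ∷ []) →
        c ~ p₁ → c ~ p₂ → c ~ p₃ → c ~ p₄ → p₁ ~ p₂ → p₂ ~ p₃ → p₃ ~ p₄ →
        NbrsIn c S (p₁ ∷ p₂ ∷ p₃ ∷ p₄ ∷ []) → NbrsIn p₁ S (c ∷ p₂ ∷ []) → NbrsIn p₂ S (c ∷ p₁ ∷ p₃ ∷ []) →
        NbrsIn p₃ S (c ∷ p₂ ∷ p₄ ∷ []) → NbrsIn p₄ S (c ∷ p₃ ∷ []) → Fan S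
  mkFan {S} {c} {p₁} {p₂} {p₃} {p₄} V⊆S
      D@((c≢1 ∷ c≢2 ∷ c≢3 ∷ c≢4 ∷ []) ∷ (1≢2 ∷ 1≢3 ∷ 1≢4 ∷ []) ∷ (2≢3 ∷ 2≢4 ∷ []) ∷ (3≢4 ∷ []) ∷ [] ∷ [])
      c1 c2 c3 c4 e12 e23 e34 nc n1 n2 n3 n4 = record
    { vertices⊆S = V⊆S
    ; distinct = D
    ; nbrs-c = saturated nc λ { cz (z≢c ∷ z≢1 ∷ z≢2 ∷ z≢3 ∷ z≢4 ∷ []) → no-S₂,₂ c2 cz c4 (~-sym e12) e23
        (≢-sym z≢2) 2≢4 c≢1 c≢3 z≢4 1≢3 z≢1 z≢3 (≢-sym 1≢4) (≢-sym 3≢4) }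
    ; nbrs-p₁ = saturated n1 λ { 1z (z≢c ∷ z≢1 ∷ z≢2 ∷ z≢3 ∷ z≢4 ∷ []) → no-S₂,₂ (~-sym c1) e12 1z c3 c4
        c≢2 (≢-sym z≢c) 1≢3 1≢4 (≢-sym z≢2) 3≢4 2≢3 2≢4 z≢3 z≢4 }
    ; nbrs-p₂ = saturated n2 λ { 2z (z≢c ∷ z≢1 ∷ z≢2 ∷ z≢3 ∷ z≢4 ∷ []) → no-S₂,₂ (~-sym c2) (~-sym e12) 2z c3 c4
        c≢1 (≢-sym z≢c) 2≢3 2≢4 (≢-sym z≢1) 3≢4 1≢3 1≢4 z≢3 z≢4 }
    ; nbrs-p₃ = saturated n3 λ { 3z (z≢c ∷ z≢1 ∷ z≢2 ∷ z≢3 ∷ z≢4 ∷ []) → no-S₂,₂ (~-sym c3) e34 3z c1 c2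
        c≢4 (≢-sym z≢c) (≢-sym 1≢3) (≢-sym 2≢3) (≢-sym z≢4) 1≢2 (≢-sym 1≢4) (≢-sym 2≢4) z≢1 z≢2 }
    ; nbrs-p₄ = saturated n4 λ { 4z (z≢c ∷ z≢1 ∷ z≢2 ∷ z≢3 ∷ z≢4 ∷ []) → no-S₂,₂ (~-sym c4) (~-sym e34) 4z c1 c2
        c≢3 (≢-sym z≢c) (≢-sym 1≢4) (≢-sym 2≢4) (≢-sym z≢3) 1≢2 (≢-sym 1≢3) (≢-sym 2≢3) z≢1 z≢2 }
    }
    where
    V = c ∷ p₁ ∷ p₂ ∷ p₃ ∷ p₄ ∷ []
    saturated : ∀ {v M} → NbrsIn v S M → (∀ {z} → v ~ z → All (z ≢_) V → ⊥) → ∀ {z} → v ~ z → z ∈ M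
    saturated nb outside {z} v~z with z ∈? V
    ... | yes z∈V = nb (All.lookup V⊆S z∈V) v~z
    ... | no z∉V = ⊥-elim (outside v~z (¬Any⇒All¬ V z∉V))

  fan-mono : ∀ {S T} → (∀ {z} → z ∈ S → z ∈ T) → Fan S → Fan T
  fan-mono S⊆T F = record { Fan F ; vertices⊆S = All.map S⊆T (Fan.vertices⊆S F) }

  edges₅≤ : ∀ {a b c d e} T {k₁ k₂ k₃ k₄ k₅} → deg a (b ∷ c ∷ d ∷ e ∷ T) ≤ k₁ → deg b (c ∷ d ∷ e ∷ T) ≤ k₂ →
            deg c (d ∷ e ∷ T) ≤ k₃ → deg d (e ∷ T) ≤ k₄ → deg e T ≤ k₅ →
            edges (a ∷ b ∷ c ∷ d ∷ e ∷ T) ≤ k₁ + (k₂ + (k₃ + (k₄ + (k₅ + edges T))))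
  edges₅≤ T d₁ d₂ d₃ d₄ d₅ = +-mono-≤ d₁ (+-mono-≤ d₂ (+-mono-≤ d₃ (+-mono-≤ d₄ (+-monoˡ-≤ (edges T) d₅))))

  fan-bound : ∀ {S} → Unique S → (F : Fan S) → ∃ λ T → S ↭ Fan.vertices F ++ T × edges S ≤ 7 + edges T
  fan-bound {S} u F with extract (Fan.distinct F) (Fan.vertices⊆S F)
  ... | T , σ = T , σ , edges-resp-↭ σ
        -- The forward degrees 4, 1, 1, 1, 0 add up to the seven edges of the fan, and no edge leads
        -- to `T`.
        (edges₅≤ T (deg-after (c ∷ []) (p₁ ∷ p₂ ∷ p₃ ∷ p₄ ∷ []) σ u (λ _ → nbrs-c) (i1 ∷ i2 ∷ i3 ∷ i4 ∷ []))
                   (deg-after (c ∷ p₁ ∷ []) (p₂ ∷ []) σ u (λ _ → nbrs-p₁) (i0 ∷ i2 ∷ []))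
                   (deg-after (c ∷ p₁ ∷ p₂ ∷ []) (p₃ ∷ []) σ u (λ _ → nbrs-p₂) (i0 ∷ i1 ∷ i3 ∷ []))
                   (deg-after (c ∷ p₁ ∷ p₂ ∷ p₃ ∷ []) (p₄ ∷ []) σ u (λ _ → nbrs-p₃) (i0 ∷ i2 ∷ i4 ∷ []))
                   (deg-after vertices [] σ u (λ _ → nbrs-p₄) (i0 ∷ i3 ∷ [])))
    where open Fan F

-- Local configurations around an ear

module Reductions {n} (G : Graph n) (free : Free S22 G) (pos : Fin n → ℕ) (pos-injective : Injective _≡_ _≡_ pos)
  (noncrossing : ∀ u v w z → adj G u v ≡ true → adj G w z ≡ true → pos u < pos w → pos w < pos v → pos v < pos z → ⊥)
  where
  open Neighbourhoods G
  open DoubleStar G free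
  open Separation G pos pos-injective noncrossing
  open EndConfiguration G pos pos-injective noncrossing

  -- K₄⁻ with hubs `u`, `v` and tips `s`, `t`.
  record Diamond (u v s t : Fin n) : Set where
    constructor mkDiamond
    field
      uv : u ~ v
      us : u ~ s
      ut : u ~ t
      vs : v ~ s
      vt : v ~ t
      s≢t : s ≢ t

  -- The edges lost are at most 1, 3, 5 and 7 for `leaf`, `pair`, `diamond` and `five`, so the
  -- deleted vertices account for at least 1, 0, 2 and 1 of the deficiency.
  data Reduction (S : List (Fin n)) : Set where
    leaf : ∀ {v T} → S ↭ v ∷ T → deg v T ≤ 1 → Reduction S
    pair : ∀ {a b T} → S ↭ a ∷ b ∷ T → a ~ b → deg a T ≤ 1 → deg b T ≤ 1 → Reduction S
    diamond : ∀ {u v s t T} → S ↭ u ∷ v ∷ s ∷ t ∷ T → Diamond u v s t → edges S ≤ 5 + edges T → Reduction S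
    -- deg e T is kept symbolic because it vanishes when T is empty.
    five : ∀ {a b c d e T} → S ↭ a ∷ b ∷ c ∷ d ∷ e ∷ T → edges S ≤ 6 + (deg e T + edges T) → deg e T ≤ 1 → Reduction S
    fan : Fan S → Reduction S

  module _ {S : List (Fin n)} (u : Unique S) where

    reduce-leaf : ∀ {v l} → v ∈ S → NbrsIn v S (l ∷ []) → Reduction S
    reduce-leaf {v} {l} v∈ nb with ∈-↭ v∈
    ... | T , σ = leaf σ (deg-after (v ∷ []) (l ∷ []) σ u nb (i1 ∷ []))

    reduce-pair : ∀ {a b p q} → a ∈ S → b ∈ S → a ~ b → NbrsIn a S (b ∷ p ∷ []) → NbrsIn b S (a ∷ q ∷ []) → Reduction S
    reduce-pair {a} {b} {p} {q} a∈ b∈ ab na nb with extract ((~⇒≢ ab ∷ []) ∷ [] ∷ []) (a∈ ∷ b∈ ∷ [])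
    ... | T , σ = pair σ ab (deg-after (a ∷ b ∷ []) (p ∷ []) σ u na (i1 ∷ i2 ∷ []))
                            (deg-after (a ∷ b ∷ []) (q ∷ []) σ u nb (i0 ∷ i2 ∷ []))

    module Ear {a} (a∈ : a ∈ S) where

      -- The suffixes 33 and 34 are the degrees of x and y.
      triangle-33 : ∀ {x y b c} → x ∈ S → y ∈ S → b ∈ S → c ∈ S → a ~ x → a ~ y → x ~ y → x ~ b → y ~ c →
                    b ≢ a → b ≢ y → c ≢ a → c ≢ x → b ≢ c → NbrsIn a S (x ∷ y ∷ []) →
                    NbrsIn x S (a ∷ y ∷ b ∷ []) → NbrsIn y S (a ∷ x ∷ c ∷ []) → Reduction S
      triangle-33 {x} {y} {b} {c} x∈ y∈ b∈ c∈ ax ay xy xb yc b≢a b≢y c≢a c≢x b≢c na nx ny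
        with low-degree {S} (~-sym xb) xy (~-sym ax) (≢-sym (~⇒≢ ay)) b≢y b≢a
               (λ by → All¬⇒¬Any (b≢a ∷ ≢-sym (~⇒≢ xb) ∷ b≢c ∷ []) (ny b∈ (~-sym by)))
               (λ ba → All¬⇒¬Any (≢-sym (~⇒≢ xb) ∷ b≢y ∷ []) (na b∈ (~-sym ba)))
           | low-degree {S} (~-sym yc) (~-sym xy) (~-sym ay) (≢-sym (~⇒≢ ax)) c≢x c≢a
               (λ cx → All¬⇒¬Any (c≢a ∷ ≢-sym (~⇒≢ yc) ∷ ≢-sym b≢c ∷ []) (nx c∈ (~-sym cx)))
               (λ ca → All¬⇒¬Any (c≢x ∷ ≢-sym (~⇒≢ yc) ∷ []) (na c∈ (~-sym ca)))
           | extract ((~⇒≢ ax ∷ ~⇒≢ ay ∷ ≢-sym b≢a ∷ ≢-sym c≢a ∷ []) ∷ (~⇒≢ xy ∷ ~⇒≢ xb ∷ ≢-sym c≢x ∷ []) ∷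
                      (≢-sym b≢y ∷ ~⇒≢ yc ∷ []) ∷ (b≢c ∷ []) ∷ [] ∷ []) (a∈ ∷ x∈ ∷ y∈ ∷ b∈ ∷ c∈ ∷ [])
      ... | z , nb | z′ , nc | T , σ = five σ
            (edges-resp-↭ σ (edges₅≤ T
              (deg-after (a ∷ []) (x ∷ y ∷ []) σ u na (i1 ∷ i2 ∷ []))
              (deg-after (a ∷ x ∷ []) (y ∷ b ∷ []) σ u nx (i0 ∷ i2 ∷ i3 ∷ []))
              (deg-after (a ∷ x ∷ y ∷ []) (c ∷ []) σ u ny (i0 ∷ i1 ∷ i3 ∷ []))
              (deg-after (a ∷ x ∷ y ∷ b ∷ []) (z ∷ []) σ u nb (i1 ∷ i4 ∷ []))
              ≤-refl))
            (deg-after (a ∷ x ∷ y ∷ b ∷ c ∷ []) (z′ ∷ []) σ u nc (i2 ∷ there i4 ∷ []))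

      -- An S₂,₂ around `by` confines the neighbours of `b` to `x`, `y`, `w`. If `b ~ w`, the hub
      -- `y` and the path `a`, `x`, `b`, `w` form a fan; otherwise only `w` can have an edge leaving
      -- the five vertices, and at most one.
      triangle-34 : ∀ {x y b w} → x ∈ S → y ∈ S → b ∈ S → w ∈ S → a ~ x → a ~ y → x ~ y → x ~ b → y ~ b → y ~ w →
                    b ≢ a → w ≢ a → w ≢ x → b ≢ w → NbrsIn a S (x ∷ y ∷ []) →
                    NbrsIn x S (a ∷ y ∷ b ∷ []) → NbrsIn y S (a ∷ x ∷ b ∷ w ∷ []) → Reduction S
      triangle-34 {x} {y} {b} {w} x∈ y∈ b∈ w∈ ax ay xy xb yb yw b≢a w≢a w≢x b≢w na nx ny
        with low-degree {S} (~-sym yw) (~-sym xy) (~-sym ay) (≢-sym (~⇒≢ ax)) w≢x w≢a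
               (λ wx → All¬⇒¬Any (w≢a ∷ ≢-sym (~⇒≢ yw) ∷ ≢-sym b≢w ∷ []) (nx w∈ (~-sym wx)))
               (λ wa → All¬⇒¬Any (w≢x ∷ ≢-sym (~⇒≢ yw) ∷ []) (na w∈ (~-sym wa)))
           | nbrsIn-or-other b S (x ∷ y ∷ w ∷ [])
      ... | _ | inj₂ (g , g∈ , bg , g≢x ∷ g≢y ∷ g≢w ∷ []) = ⊥-elim (no-S₂,₂ (~-sym yb) (~-sym xb) bg (~-sym ay) yw
              (~⇒≢ (~-sym xy)) (≢-sym g≢y) b≢a b≢w (≢-sym g≢x) (≢-sym w≢a) (≢-sym (~⇒≢ ax)) (≢-sym w≢x)
              (λ { ≡-refl → All¬⇒¬Any (~⇒≢ (~-sym xb) ∷ ~⇒≢ (~-sym yb) ∷ []) (na b∈ (~-sym bg)) }) g≢w)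
      ... | z , nw | inj₁ nb with b ~? w
      ...   | yes bw = fan (mkFan (y∈ ∷ a∈ ∷ x∈ ∷ b∈ ∷ w∈ ∷ [])
              ((~⇒≢ (~-sym ay) ∷ ~⇒≢ (~-sym xy) ∷ ~⇒≢ yb ∷ ~⇒≢ yw ∷ []) ∷ (~⇒≢ ax ∷ ≢-sym b≢a ∷ ≢-sym w≢a ∷ []) ∷
               (~⇒≢ xb ∷ ≢-sym w≢x ∷ []) ∷ (b≢w ∷ []) ∷ [] ∷ [])
              (~-sym ay) (~-sym xy) yb yw ax xb bw ny (weaken na (i1 ∷ i0 ∷ [])) (weaken nx (i1 ∷ i0 ∷ i2 ∷ []))
              (weaken nb (i1 ∷ i0 ∷ i2 ∷ [])) (weaken nw (i0 ∷ z∈yb ∷ [])))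
        where
        -- The neighbours of `w` are among `y` and `z`, and `b` is one of them, so `z` is `b`.
        z∈yb : z ∈ y ∷ b ∷ []
        z∈yb with nw b∈ (~-sym bw)
        ... | i0 = ⊥-elim (~⇒≢ yb ≡-refl)
        ... | i1 = i1
      ...   | no b≁w with extract ((~⇒≢ ax ∷ ~⇒≢ ay ∷ ≢-sym b≢a ∷ ≢-sym w≢a ∷ []) ∷ (~⇒≢ xy ∷ ~⇒≢ xb ∷ ≢-sym w≢x ∷ []) ∷
                      (~⇒≢ yb ∷ ~⇒≢ yw ∷ []) ∷ (b≢w ∷ []) ∷ [] ∷ []) (a∈ ∷ x∈ ∷ y∈ ∷ b∈ ∷ w∈ ∷ [])
      ...     | T , σ = five σ
            (edges-resp-↭ σ (edges₅≤ T
              (deg-after (a ∷ []) (x ∷ y ∷ []) σ u na (i1 ∷ i2 ∷ []))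
              (deg-after (a ∷ x ∷ []) (y ∷ b ∷ []) σ u nx (i0 ∷ i2 ∷ i3 ∷ []))
              (deg-after (a ∷ x ∷ y ∷ []) (b ∷ w ∷ []) σ u ny (i0 ∷ i1 ∷ i3 ∷ i4 ∷ []))
              (deg-after (a ∷ x ∷ y ∷ b ∷ []) [] σ u nb′ (i1 ∷ i2 ∷ []))
              ≤-refl))
            (deg-after (a ∷ x ∷ y ∷ b ∷ w ∷ []) (z ∷ []) σ u nw (i2 ∷ there i4 ∷ []))
        where
        nb′ : NbrsIn b S (x ∷ y ∷ [])
        nb′ z∈ bz with nb z∈ bz
        ... | i0 = i0
        ... | i1 = i1
        ... | i2 = ⊥-elim (b≁w bz)

      -- Either `b` has no neighbour besides `x` and `y`, and the diamond is cut off from the rest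
      -- of `S`, or an S₂,₂ around `xb` leaves `b` exactly one more neighbour `w`. Then `low-degree`
      -- allows `w` one edge beyond the five vertices.
      triangle-diamond : ∀ {x y b} → x ∈ S → y ∈ S → b ∈ S → a ~ x → a ~ y → x ~ y → x ~ b → y ~ b →
                         b ≢ a → NbrsIn a S (x ∷ y ∷ []) →
                         NbrsIn x S (a ∷ y ∷ b ∷ []) → NbrsIn y S (a ∷ x ∷ b ∷ []) → Reduction S
      triangle-diamond {x} {y} {b} x∈ y∈ b∈ ax ay xy xb yb b≢a na nx ny with nbrsIn-or-other b S (x ∷ y ∷ [])
      ... | inj₁ nb with extract ((~⇒≢ xy ∷ ~⇒≢ (~-sym ax) ∷ ~⇒≢ xb ∷ []) ∷ (~⇒≢ (~-sym ay) ∷ ~⇒≢ yb ∷ []) ∷ (≢-sym b≢a ∷ []) ∷ [] ∷ [])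
                           (x∈ ∷ y∈ ∷ a∈ ∷ b∈ ∷ [])
      ...   | T , σ = diamond σ (mkDiamond xy (~-sym ax) xb (~-sym ay) yb (≢-sym b≢a))
            (edges-resp-↭ σ
              (+-mono-≤ (deg-after (x ∷ []) (y ∷ a ∷ b ∷ []) σ u nx (i2 ∷ i1 ∷ i3 ∷ []))
              (+-mono-≤ (deg-after (x ∷ y ∷ []) (a ∷ b ∷ []) σ u ny (i2 ∷ i0 ∷ i3 ∷ []))
              (+-mono-≤ (deg-after (x ∷ y ∷ a ∷ []) [] σ u na (i0 ∷ i1 ∷ []))
              (+-monoˡ-≤ (edges T) (deg-after (x ∷ y ∷ a ∷ b ∷ []) [] σ u nb (i0 ∷ i1 ∷ [])))))))
      triangle-diamond {x} {y} {b} x∈ y∈ b∈ ax ay xy xb yb b≢a na nx ny | inj₂ (w , w∈ , bw , w≢x ∷ w≢y ∷ [])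
        with nbrsIn-or-other b S (x ∷ y ∷ w ∷ [])
      ... | inj₂ (g , g∈ , bg , g≢x ∷ g≢y ∷ g≢w ∷ []) = ⊥-elim (no-S₂,₂ xb xy (~-sym ax) bw bg
              (~⇒≢ (~-sym yb)) b≢a (≢-sym w≢x) (≢-sym g≢x) (≢-sym (~⇒≢ ay)) (≢-sym g≢w) (≢-sym w≢y) (≢-sym g≢y) (a≢ bw) (a≢ bg))
        where
        a≢ : ∀ {z} → b ~ z → a ≢ z
        a≢ bz ≡-refl = All¬⇒¬Any (~⇒≢ (~-sym xb) ∷ ~⇒≢ (~-sym yb) ∷ []) (na b∈ (~-sym bz))
      ... | inj₁ nb with low-degree {S} (~-sym bw) (~-sym xb) (~-sym yb) (~⇒≢ xy) w≢x w≢y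
                           (λ wx → All¬⇒¬Any (≢-sym a≢w ∷ w≢y ∷ ≢-sym (~⇒≢ bw) ∷ []) (nx w∈ (~-sym wx)))
                           (λ wy → All¬⇒¬Any (≢-sym a≢w ∷ w≢x ∷ ≢-sym (~⇒≢ bw) ∷ []) (ny w∈ (~-sym wy)))
                       | extract ((~⇒≢ ax ∷ ~⇒≢ ay ∷ ≢-sym b≢a ∷ a≢w ∷ []) ∷ (~⇒≢ xy ∷ ~⇒≢ xb ∷ ≢-sym w≢x ∷ []) ∷
                           (~⇒≢ yb ∷ ≢-sym w≢y ∷ []) ∷ (~⇒≢ bw ∷ []) ∷ [] ∷ []) (a∈ ∷ x∈ ∷ y∈ ∷ b∈ ∷ w∈ ∷ [])
        where
        a≢w : a ≢ w
        a≢w ≡-refl = All¬⇒¬Any (~⇒≢ (~-sym xb) ∷ ~⇒≢ (~-sym yb) ∷ []) (na b∈ (~-sym bw))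
      ...   | z , nw | T , σ = five σ
            (edges-resp-↭ σ (edges₅≤ T
              (deg-after (a ∷ []) (x ∷ y ∷ []) σ u na (i1 ∷ i2 ∷ []))
              (deg-after (a ∷ x ∷ []) (y ∷ b ∷ []) σ u nx (i0 ∷ i2 ∷ i3 ∷ []))
              (deg-after (a ∷ x ∷ y ∷ []) (b ∷ []) σ u ny (i0 ∷ i1 ∷ i3 ∷ []))
              (deg-after (a ∷ x ∷ y ∷ b ∷ []) (w ∷ []) σ u nb (i1 ∷ i2 ∷ i4 ∷ []))
              ≤-refl))
            (deg-after (a ∷ x ∷ y ∷ b ∷ w ∷ []) (z ∷ []) σ u nw (i3 ∷ there i4 ∷ []))

      -- Beyond `a` and `b`, the ends of `xy` have at most one further neighbour in total: two
      -- distinct ones form an S₂,₂ around `xy` with `a` and `b` as the other leaves, and a shared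
      -- one gives a K₂,₃.
      ear-common : ∀ {x y b} → x ∈ S → y ∈ S → b ∈ S → a ~ x → a ~ y → x ~ y → x ~ b → y ~ b → b ≢ a →
                   NbrsIn a S (x ∷ y ∷ []) → Reduction S
      ear-common {x} {y} {b} x∈ y∈ b∈ ax ay xy xb yb b≢a na
        with nbrsIn-or-other x S (a ∷ y ∷ b ∷ []) | nbrsIn-or-other y S (a ∷ x ∷ b ∷ [])
      ... | inj₁ nx | inj₁ ny = triangle-diamond x∈ y∈ b∈ ax ay xy xb yb b≢a na nx ny
      ... | inj₂ (d , d∈ , xd , d≢a ∷ d≢y ∷ d≢b ∷ []) | inj₂ (f , f∈ , yf , f≢a ∷ f≢x ∷ f≢b ∷ []) with f ≟ᶠ d
      ...   | yes ≡-refl = ⊥-elim (no-K₂,₃ (~⇒≢ xy) (~-sym ax) (~-sym ay) xb yb xd yf (≢-sym b≢a) (≢-sym d≢b) (≢-sym d≢a))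
      ...   | no f≢d = ⊥-elim (no-S₂,₂ xy (~-sym ax) xd yb yf (≢-sym (~⇒≢ ay)) (≢-sym d≢y) (~⇒≢ xb) (≢-sym f≢x)
                        (≢-sym d≢a) (≢-sym f≢b) (≢-sym b≢a) (≢-sym f≢a) d≢b (≢-sym f≢d))
      ear-common {x} {y} {b} x∈ y∈ b∈ ax ay xy xb yb b≢a na | inj₁ nx | inj₂ (f , f∈ , yf , f≢a ∷ f≢x ∷ f≢b ∷ [])
        with nbrsIn-or-other y S (a ∷ x ∷ b ∷ f ∷ [])
      ... | inj₁ ny = triangle-34 x∈ y∈ b∈ f∈ ax ay xy xb yb yf b≢a f≢a f≢x (≢-sym f≢b) na nx ny
      ... | inj₂ (g , g∈ , yg , g≢a ∷ g≢x ∷ g≢b ∷ g≢f ∷ []) = ⊥-elim (no-S₂,₂ xy (~-sym ax) xb yf yg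
              (≢-sym (~⇒≢ ay)) (~⇒≢ yb) (≢-sym f≢x) (≢-sym g≢x) (≢-sym b≢a) (≢-sym g≢f) (≢-sym f≢a) (≢-sym g≢a) (≢-sym f≢b) (≢-sym g≢b))
      ear-common {x} {y} {b} x∈ y∈ b∈ ax ay xy xb yb b≢a na | inj₂ (d , d∈ , xd , d≢a ∷ d≢y ∷ d≢b ∷ []) | inj₁ ny
        with nbrsIn-or-other x S (a ∷ y ∷ b ∷ d ∷ [])
      ... | inj₁ nx = triangle-34 y∈ x∈ b∈ d∈ ay ax (~-sym xy) yb xb xd b≢a d≢a d≢y (≢-sym d≢b) (weaken na (i1 ∷ i0 ∷ [])) ny nx
      ... | inj₂ (g , g∈ , xg , g≢a ∷ g≢y ∷ g≢b ∷ g≢d ∷ []) = ⊥-elim (no-S₂,₂ (~-sym xy) (~-sym ay) yb xd xg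
              (≢-sym (~⇒≢ ax)) (~⇒≢ xb) (≢-sym d≢y) (≢-sym g≢y) (≢-sym b≢a) (≢-sym g≢d) (≢-sym d≢a) (≢-sym g≢a) (≢-sym d≢b) (≢-sym g≢b))

      -- The split is on whether `x` and `y` have a second common neighbour. If not, both have
      -- degree three: with a fourth neighbour at one end, `a`, which is adjacent to both ends,
      -- serves as the missing leaf at the other.
      reduce-ear : ∀ {x y} → x ∈ S → y ∈ S → a ~ x → a ~ y → x ~ y → NbrsIn a S (x ∷ y ∷ []) → Reduction S
      reduce-ear {x} {y} x∈ y∈ ax ay xy na with nbrsIn-or-other x S (a ∷ y ∷ []) | nbrsIn-or-other y S (a ∷ x ∷ [])
      ... | inj₁ nx | _ = reduce-pair a∈ x∈ ax na nx
      ... | _ | inj₁ ny = reduce-pair a∈ y∈ ay (weaken na (i1 ∷ i0 ∷ [])) ny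
      ... | inj₂ (b , b∈ , xb , b≢a ∷ b≢y ∷ []) | inj₂ (c , c∈ , yc , c≢a ∷ c≢x ∷ []) with x ~? c | y ~? b
      ...   | yes xc | _ = ear-common x∈ y∈ c∈ ax ay xy xc yc c≢a na
      ...   | _ | yes yb = ear-common x∈ y∈ b∈ ax ay xy xb yb b≢a na
      ...   | no x≁c | no y≁b with nbrsIn-or-other x S (a ∷ y ∷ b ∷ []) | nbrsIn-or-other y S (a ∷ x ∷ c ∷ [])
      ...     | inj₁ nx | inj₁ ny = triangle-33 x∈ y∈ b∈ c∈ ax ay xy xb yc b≢a b≢y c≢a c≢x (λ { ≡-refl → x≁c xb }) na nx ny
      ...     | inj₂ (d , d∈ , xd , d≢a ∷ d≢y ∷ d≢b ∷ []) | _ = ⊥-elim (no-S₂,₂ xy xb xd (~-sym ay) yc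
                  (≢-sym b≢y) (≢-sym d≢y) (≢-sym (~⇒≢ ax)) (≢-sym c≢x) (≢-sym d≢b) (≢-sym c≢a) b≢a (λ { ≡-refl → x≁c xb }) d≢a (λ { ≡-refl → x≁c xd }))
      ...     | _ | inj₂ (f , f∈ , yf , f≢a ∷ f≢x ∷ f≢c ∷ []) = ⊥-elim (no-S₂,₂ xy (~-sym ax) xb yc yf
                  (≢-sym (~⇒≢ ay)) (≢-sym b≢y) (≢-sym c≢x) (≢-sym f≢x) (≢-sym b≢a) (≢-sym f≢c) (≢-sym c≢a) (≢-sym f≢a) (λ { ≡-refl → x≁c xb }) (λ { ≡-refl → y≁b yf }))

    reduction : ∀ {v} → v ∈ S → Reduction S
    reduction v∈ with config v∈
    ... | leaf v∈ nb = reduce-leaf v∈ nb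
    ... | pair a∈ b∈ ab na nb = reduce-pair a∈ b∈ ab na nb
    ... | ear a∈ x∈ y∈ ax ay xy na = Ear.reduce-ear a∈ x∈ y∈ ax ay xy na

-- The least value of 3n − 2e over S₂,₂-free outerplanar graphs, capped at 3.
deficiency : ℕ → ℕ
deficiency 0 = 0
deficiency 4 = 2
deficiency 5 = 1
deficiency 10 = 2
deficiency _ = 3

deficiency≤3 : ∀ m → deficiency m ≤ 3
deficiency≤3 0 = ≤ᵇ⇒≤ _ _ _
deficiency≤3 1 = ≤-refl
deficiency≤3 2 = ≤-refl
deficiency≤3 3 = ≤-refl
deficiency≤3 4 = ≤ᵇ⇒≤ _ _ _
deficiency≤3 5 = ≤ᵇ⇒≤ _ _ _
deficiency≤3 6 = ≤-refl
deficiency≤3 7 = ≤-refl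
deficiency≤3 8 = ≤-refl
deficiency≤3 9 = ≤-refl
deficiency≤3 10 = ≤ᵇ⇒≤ _ _ _
deficiency≤3 (suc (suc (suc (suc (suc (suc (suc (suc (suc (suc (suc _))))))))))) = ≤-refl

-- A fan contributes `3 · 5 − 2 · 7 = 1`, so adding five vertices must not raise the promised value
-- by more than that.
deficiency-fan : ∀ m → deficiency (5 + m) ≤ suc (deficiency m)
deficiency-fan 0 = ≤-refl
deficiency-fan 1 = ≤ᵇ⇒≤ _ _ _
deficiency-fan 2 = ≤ᵇ⇒≤ _ _ _
deficiency-fan 3 = ≤ᵇ⇒≤ _ _ _
deficiency-fan 4 = ≤-refl
deficiency-fan 5 = ≤-refl
deficiency-fan 6 = ≤ᵇ⇒≤ _ _ _
deficiency-fan 7 = ≤ᵇ⇒≤ _ _ _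
deficiency-fan 8 = ≤ᵇ⇒≤ _ _ _
deficiency-fan 9 = ≤ᵇ⇒≤ _ _ _
deficiency-fan 10 = ≤-refl
deficiency-fan (suc (suc (suc (suc (suc (suc (suc (suc (suc (suc (suc _))))))))))) = ≤ᵇ⇒≤ _ _ _

-- Restoring `j` vertices and at most `k` edges changes `3n − 2e` by at least `3j − 2k`; `c` is the
-- value known for the remainder and `c′` the one claimed for the whole.
extend-bound : ∀ k j {E N c′ e m c} → E ≤ k + e → c′ + 2 * k ≤ 3 * j + c → N ≡ j + m → 2 * e + c ≤ 3 * m → 2 * E + c′ ≤ 3 * N
extend-bound k j {E} {_} {c′} {e} {m} {c} E≤ kj ≡-refl em = begin
  2 * E + c′           ≤⟨ +-monoˡ-≤ c′ (*-monoʳ-≤ 2 E≤) ⟩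
  2 * (k + e) + c′     ≡⟨ expand k e c′ ⟩
  c′ + 2 * k + 2 * e   ≤⟨ +-monoˡ-≤ (2 * e) kj ⟩
  3 * j + c + 2 * e    ≡⟨ regroup (3 * j) c (2 * e) ⟩
  3 * j + (2 * e + c)  ≤⟨ +-monoʳ-≤ (3 * j) em ⟩
  3 * j + 3 * m        ≡⟨ *-distribˡ-+ 3 j m ⟨
  3 * (j + m)          ∎
  where
  open ≤-Reasoning
  expand : ∀ k e c → 2 * (k + e) + c ≡ c + 2 * k + 2 * e
  expand = solve-∀
  regroup : ∀ a b c → a + b + c ≡ a + (c + b)
  regroup = solve-∀

-- Induction over vertex sets

module Bound {n} (G : Graph n) (free : Free S22 G) (pos : Fin n → ℕ) (pos-injective : Injective _≡_ _≡_ pos)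
  (noncrossing : ∀ u v w z → adj G u v ≡ true → adj G w z ≡ true → pos u < pos w → pos w < pos v → pos v < pos z → ⊥)
  where
  open Neighbourhoods G
  open DoubleStar G free
  open Separation G pos pos-injective noncrossing
  open Reductions G free pos pos-injective noncrossing

  swap-hubs : ∀ {u v s t} → Diamond u v s t → Diamond v u s t
  swap-hubs (mkDiamond uv us ut vs vt s≢t) = mkDiamond (~-sym uv) vs vt us ut s≢t

  swap-tips : ∀ {u v s t} → Diamond u v s t → Diamond u v t s
  swap-tips (mkDiamond uv us ut vs vt s≢t) = mkDiamond uv ut us vt vs (≢-sym s≢t)

  module _ {a b u v s t} (D : Diamond u v s t) (a~b : a ~ b) (a∉ : a ∉ u ∷ v ∷ s ∷ t ∷ []) (b∉ : b ∉ u ∷ v ∷ s ∷ t ∷ []) where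

    private
      open Diamond D
      a≢ : All (a ≢_) (u ∷ v ∷ s ∷ t ∷ [])
      a≢ = ¬Any⇒All¬ _ a∉
      b≢ : All (b ≢_) (u ∷ v ∷ s ∷ t ∷ [])
      b≢ = ¬Any⇒All¬ _ b∉

    hub-hub : a ~ u → b ~ u → ⊥
    hub-hub au bu with a≢ | b≢
    ... | _ ∷ a≢v ∷ a≢s ∷ a≢t ∷ [] | _ ∷ b≢v ∷ b≢s ∷ b≢t ∷ [] = no-S₂,₂ uv (~-sym au) (~-sym bu) vs vt
      (≢-sym a≢v) (≢-sym b≢v) (~⇒≢ us) (~⇒≢ ut) (~⇒≢ a~b) s≢t a≢s a≢t b≢s b≢t

    hub-other-hub : a ~ u → b ~ v → ⊥
    hub-other-hub au bv with a≢ | b≢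
    ... | _ ∷ a≢v ∷ a≢s ∷ a≢t ∷ [] | b≢u ∷ _ ∷ b≢s ∷ b≢t ∷ [] = no-S₂,₂ uv (~-sym au) us (~-sym bv) vt
      (≢-sym a≢v) (~⇒≢ vs) (≢-sym b≢u) (~⇒≢ ut) a≢s b≢t (~⇒≢ a~b) a≢t (≢-sym b≢s) s≢t

    hub-tip : a ~ u → b ~ s → ⊥
    hub-tip au bs with a≢ | b≢
    ... | _ ∷ a≢v ∷ a≢s ∷ a≢t ∷ [] | b≢u ∷ b≢v ∷ _ ∷ b≢t ∷ [] = no-S₂,₂ us (~-sym au) ut (~-sym bs) (~-sym vs)
      (≢-sym a≢s) s≢t (≢-sym b≢u) (~⇒≢ uv) a≢t b≢v (~⇒≢ a~b) a≢v (≢-sym b≢t) (~⇒≢ (~-sym vt))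

    tip-tip : a ~ s → b ~ s → ⊥
    tip-tip as bs with a≢ | b≢
    ... | a≢u ∷ a≢v ∷ _ ∷ a≢t ∷ [] | b≢u ∷ b≢v ∷ _ ∷ b≢t ∷ [] = no-S₂,₂ (~-sym us) (~-sym as) (~-sym bs) uv ut
      (≢-sym a≢u) (≢-sym b≢u) (~⇒≢ (~-sym vs)) s≢t (~⇒≢ a~b) (~⇒≢ vt) a≢v a≢t b≢v b≢t

    tip-other-tip : a ~ s → b ~ t → ⊥
    tip-other-tip as bt with a≢ | b≢
    ... | a≢u ∷ a≢v ∷ _ | b≢u ∷ b≢v ∷ _ = no-detour uv us vs ut vt s≢t (~-sym as) a~b bt a≢u a≢v b≢u b≢v

  hubs-swapped : ∀ {x u v s t : Fin n} → x ∉ u ∷ v ∷ s ∷ t ∷ [] → x ∉ v ∷ u ∷ s ∷ t ∷ []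
  hubs-swapped x∉ = x∉ ∘ ∈-resp-↭ (swap _ _ refl)

  tips-swapped : ∀ {x u v s t : Fin n} → x ∉ u ∷ v ∷ s ∷ t ∷ [] → x ∉ u ∷ v ∷ t ∷ s ∷ []
  tips-swapped x∉ = x∉ ∘ ∈-resp-↭ (prep _ (prep _ (swap _ _ refl)))

  -- The sixteen attachments reduce to the five above by exchanging the hubs, the tips, or the ends
  -- of `ab`.
  no-handle : ∀ {a b p q u v s t} → Diamond u v s t → a ~ b → a ∉ u ∷ v ∷ s ∷ t ∷ [] → b ∉ u ∷ v ∷ s ∷ t ∷ [] →
              p ∈ u ∷ v ∷ s ∷ t ∷ [] → q ∈ u ∷ v ∷ s ∷ t ∷ [] → a ~ p → b ~ q → ⊥
  no-handle D ab a∉ b∉ i0 i0 = hub-hub D ab a∉ b∉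
  no-handle D ab a∉ b∉ i0 i1 = hub-other-hub D ab a∉ b∉
  no-handle D ab a∉ b∉ i0 i2 = hub-tip D ab a∉ b∉
  no-handle D ab a∉ b∉ i0 i3 = hub-tip (swap-tips D) ab (tips-swapped a∉) (tips-swapped b∉)
  no-handle D ab a∉ b∉ i2 i2 = tip-tip D ab a∉ b∉
  no-handle D ab a∉ b∉ i2 i3 = tip-other-tip D ab a∉ b∉
  no-handle D ab a∉ b∉ i2 i0 ap bq = hub-tip D (~-sym ab) b∉ a∉ bq ap
  no-handle D ab a∉ b∉ i2 i1 ap bq = hub-tip (swap-hubs D) (~-sym ab) (hubs-swapped b∉) (hubs-swapped a∉) bq ap
  no-handle D ab a∉ b∉ i3 i3 = tip-tip (swap-tips D) ab (tips-swapped a∉) (tips-swapped b∉)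
  no-handle D ab a∉ b∉ i3 i2 = tip-other-tip (swap-tips D) ab (tips-swapped a∉) (tips-swapped b∉)
  no-handle D ab a∉ b∉ i3 i0 ap bq = hub-tip (swap-tips D) (~-sym ab) (tips-swapped b∉) (tips-swapped a∉) bq ap
  no-handle D ab a∉ b∉ i3 i1 ap bq = hub-tip (swap-hubs (swap-tips D)) (~-sym ab) (hubs-swapped (tips-swapped b∉)) (hubs-swapped (tips-swapped a∉)) bq ap
  no-handle D ab a∉ b∉ i1 i0 ap bq = hub-other-hub D (~-sym ab) b∉ a∉ bq ap
  no-handle D ab a∉ b∉ i1 i1 = hub-hub (swap-hubs D) ab (hubs-swapped a∉) (hubs-swapped b∉)
  no-handle D ab a∉ b∉ i1 i2 = hub-tip (swap-hubs D) ab (hubs-swapped a∉) (hubs-swapped b∉)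
  no-handle D ab a∉ b∉ i1 i3 = hub-tip (swap-hubs (swap-tips D)) ab (hubs-swapped (tips-swapped a∉)) (hubs-swapped (tips-swapped b∉))

  no-nbrs : ∀ {x T} → Unique T → NbrsIn x T [] → deg x T ≡ 0
  no-nbrs u nb = n≤0⇒n≡0 (deg≤ u nb)

  -- In general a pair carries three edges. On a diamond, `no-handle` leaves one end without a
  -- neighbour there, which saves the edge needed to get from 2 to at least 3.
  pair-on-diamond : ∀ {S a b T u v s t} → Unique S → S ↭ a ∷ b ∷ T → a ~ b → deg a T ≤ 1 → deg b T ≤ 1 →
                    T ↭ u ∷ v ∷ s ∷ t ∷ [] → Diamond u v s t → edges S ≤ 2 + edges T
  pair-on-diamond {S} {a} {b} {T} uniq σ ab da db τ D with Unique-resp-↭ σ uniq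
  ... | a≢ ∷ b≢ ∷ uT with nbrsIn-or-other a T [] | nbrsIn-or-other b T []
  ...   | inj₁ na | _ = edges-resp-↭ σ
            (≤-trans (≤-reflexive (cong₂ (λ k l → [ k ] + l + (deg b T + edges T)) ab (no-nbrs uT na))) (s≤s (+-monoˡ-≤ (edges T) db)))
  ...   | _ | inj₁ nb = edges-resp-↭ σ
            (≤-trans (≤-reflexive (cong₂ (λ k l → [ k ] + deg a T + (l + edges T)) ab (no-nbrs uT nb))) (s≤s (+-monoˡ-≤ (edges T) da)))
  ...   | inj₂ (p , p∈ , ap , _) | inj₂ (q , q∈ , bq , _) = ⊥-elim (no-handle D ab
            (All¬⇒¬Any (All.tail a≢) ∘ ∈-resp-↭ (↭-sym τ)) (All¬⇒¬Any b≢ ∘ ∈-resp-↭ (↭-sym τ))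
            (∈-resp-↭ τ p∈) (∈-resp-↭ τ q∈) ap bq)

  -- The case `fan` carries no bound, so it survives the return of any vertices; its edges are
  -- counted in `edges-bound`.
  data Shape (S : List (Fin n)) : Set where
    empty : S ≡ [] → Shape S
    sparse : 2 * edges S + 3 ≤ 3 * length S → Shape S
    diamond : ∀ {u v s t} → S ↭ u ∷ v ∷ s ∷ t ∷ [] → Diamond u v s t → edges S ≤ 5 → Shape S
    fan : Fan S → Shape S

  diamond-bound : ∀ {T} {u v s t : Fin n} → T ↭ u ∷ v ∷ s ∷ t ∷ [] → edges T ≤ 5 → 2 * edges T + 2 ≤ 3 * length T
  diamond-bound {T} τ e≤5 = extend-bound 5 4 {e = 0} {m = 0} {c = 0} e≤5 (≤ᵇ⇒≤ _ _ _) (↭-length τ) z≤n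

  fan-above : ∀ {S T} L → S ↭ L ++ T → Fan T → Shape S
  fan-above L σ F = fan (fan-mono (λ z∈ → ∈-resp-↭ (↭-sym σ) (∈-++⁺ʳ L z∈)) F)

  length-rest : ∀ {S T : List (Fin n)} {x k} L → S ↭ x ∷ L ++ T → length S ≤ suc k → length T ≤ k
  length-rest {T = T} L σ S≤ = ≤-trans (≤-trans (m≤n+m (length T) (length L)) (≤-reflexive (≡-sym (length-++ L))))
                               (≤-pred (≤-trans (≤-reflexive (≡-sym (↭-length σ))) S≤))

  -- `rec` is the induction hypothesis; the nonempty prefix `x ∷ L` ensures that at least one vertex
  -- has been deleted.
  shape-step : ∀ {S} → Unique S → Reduction S → (∀ {x L T} → S ↭ (x ∷ L) ++ T → Shape T) → Shape S
  shape-step {S} u (leaf {v} {T} σ d) rec with rec {L = []} σ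
  ... | empty ≡-refl = sparse (extend-bound 0 1 {e = 0} {c = 0} (edges-resp-↭ σ z≤n) ≤-refl (↭-length σ) z≤n)
  ... | sparse b = sparse (extend-bound 1 1 {e = edges T} (edges-resp-↭ σ (+-monoˡ-≤ (edges T) d)) (≤ᵇ⇒≤ _ _ _) (↭-length σ) b)
  ... | diamond τ D e = sparse (extend-bound 1 1 {e = edges T} (edges-resp-↭ σ (+-monoˡ-≤ (edges T) d)) (≤ᵇ⇒≤ _ _ _) (↭-length σ) (diamond-bound τ e))
  ... | fan F = fan-above (v ∷ []) σ F
  shape-step {S} u (pair {a} {b} {T} σ ab da db) rec with rec {L = _ ∷ []} σ
  ... | empty ≡-refl = sparse (extend-bound 1 2 {e = 0} {c = 0} (edges-resp-↭ σ (≤-reflexive (cong (λ k → [ k ] + 0 + 0) ab))) (≤ᵇ⇒≤ _ _ _) (↭-length σ) z≤n)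
  ... | sparse e = sparse (extend-bound 3 2 {e = edges T} (edges-resp-↭ σ bound) (≤ᵇ⇒≤ _ _ _) (↭-length σ) e)
    where
    bound : edges (a ∷ b ∷ T) ≤ 3 + edges T
    bound rewrite ab = s≤s (+-mono-≤ da (+-monoˡ-≤ (edges T) db))
  ... | diamond τ D e = sparse (extend-bound 2 2 {e = edges T} (pair-on-diamond u σ ab da db τ D) (≤ᵇ⇒≤ _ _ _) (↭-length σ) (diamond-bound τ e))
  ... | fan F = fan-above (a ∷ b ∷ []) σ F
  shape-step u (diamond {a} {b} {c} {d} {T} σ D E) rec with rec {L = _ ∷ _ ∷ _ ∷ []} σ
  ... | empty ≡-refl = diamond σ D E
  ... | sparse b = sparse (extend-bound 5 4 {e = edges T} E (≤ᵇ⇒≤ _ _ _) (↭-length σ) b)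
  ... | diamond τ _ e = sparse (extend-bound 5 4 {e = edges T} E (≤ᵇ⇒≤ _ _ _) (↭-length σ) (diamond-bound τ e))
  ... | fan F = fan-above (a ∷ b ∷ c ∷ d ∷ []) σ F
  shape-step u (five {a} {b} {c} {d} {e} {T} σ E E′) rec with rec {L = _ ∷ _ ∷ _ ∷ _ ∷ []} σ
  -- Here `deg e []` computes to 0, and six edges on five vertices give exactly 3; a seventh would
  -- leave only 1.
  ... | empty ≡-refl = sparse (extend-bound 6 5 {e = 0} {c = 0} E (≤ᵇ⇒≤ _ _ _) (↭-length σ) z≤n)
  ... | sparse b = sparse (extend-bound 7 5 {e = edges T} (≤-trans E (+-monoʳ-≤ 6 (+-monoˡ-≤ (edges T) E′))) (≤ᵇ⇒≤ _ _ _) (↭-length σ) b)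
  ... | diamond τ _ b = sparse (extend-bound 7 5 {e = edges T} (≤-trans E (+-monoʳ-≤ 6 (+-monoˡ-≤ (edges T) E′))) (≤ᵇ⇒≤ _ _ _) (↭-length σ) (diamond-bound τ b))
  ... | fan F = fan-above (a ∷ b ∷ c ∷ d ∷ e ∷ []) σ F
  shape-step u (fan F) rec = fan F

  shape : ∀ k {S} → Unique S → length S ≤ k → Shape S
  shape k {[]} u _ = empty ≡-refl
  shape (suc k) {S@(_ ∷ _)} u S≤ = shape-step u (reduction u i0)
    (λ {x} {L} σ → shape k (Unique-++⁻ʳ (x ∷ L) (Unique-resp-↭ σ u)) (length-rest L σ S≤))

  -- Fans are split off one at a time; after each, the shape of the rest is determined anew, and
  -- `deficiency` keeps track of the total by size.
  edges-bound : ∀ k {S} → Unique S → length S ≤ k → 2 * edges S + deficiency (length S) ≤ 3 * length S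
  edges-bound k {S} u S≤ with shape k u S≤
  ... | empty ≡-refl = z≤n
  ... | sparse b = ≤-trans (+-monoʳ-≤ (2 * edges S) (deficiency≤3 (length S))) b
  ... | diamond σ D e = subst (λ l → 2 * edges S + deficiency l ≤ 3 * length S) (≡-sym (↭-length σ)) (diamond-bound σ e)
  edges-bound zero {[]} u S≤ | fan F = z≤n
  edges-bound (suc k) {S} u S≤ | fan F with fan-bound u F
  ... | T , σ , E = subst (λ l → 2 * edges S + deficiency l ≤ 3 * length S) (≡-sym (↭-length σ))
        (extend-bound 7 5 {e = edges T} E (≤-trans (+-monoˡ-≤ 14 (deficiency-fan (length T))) (≤-reflexive (regroup _)))
          (↭-length σ) (edges-bound k (Unique-++⁻ʳ (Fan.vertices F) (Unique-resp-↭ σ u)) (length-rest (_ ∷ _ ∷ _ ∷ _ ∷ []) σ S≤)))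
    where
    regroup : ∀ c → suc c + 14 ≡ 15 + c
    regroup = solve-∀

-- From deficiency to the upper bound

halve : ∀ m e → 2 * e + 3 ≤ 3 * suc m → e ≤ (3 * m) / 2
halve m e b = begin
  e           ≡⟨ m*n/n≡m e 2 ⟨
  e * 2 / 2   ≤⟨ /-monoˡ-≤ 2 (+-cancelʳ-≤ 3 (e * 2) (3 * m) (≤-trans (≤-reflexive (cong (_+ 3) (*-comm e 2))) (≤-trans b (≤-reflexive (expand m))))) ⟩
  3 * m / 2   ∎
  where
  open ≤-Reasoning
  expand : ∀ m → 3 * suc m ≡ 3 * m + 3
  expand = solve-∀

≤-exS22 : ∀ m e → 2 * e + deficiency (6 + m) ≤ 3 * (6 + m) → e ≤ exS22 (6 + m)
≤-exS22 0 e = halve 5 e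
≤-exS22 1 e = halve 6 e
≤-exS22 2 e = halve 7 e
≤-exS22 3 e = halve 8 e
-- For ten vertices the deficiency is 2, and `2e + 2 ≤ 30` is `2e ≤ 28`.
≤-exS22 4 e b = *-cancelˡ-≤ 2 (+-cancelʳ-≤ 2 (2 * e) 28 b)
≤-exS22 (suc (suc (suc (suc (suc m))))) e = halve (10 + m) e

upper-bound : ∀ m (G : Graph (6 + m)) → OPFree S22 (6 + m) G → edgeCount G ≤ exS22 (6 + m)
upper-bound m G ((pos , pos-injective , noncrossing) , free) = ≤-exS22 m (edgeCount G)
  (subst₂ (λ e l → 2 * e + deficiency l ≤ 3 * l) (≡-sym (edgeCount≡edges G)) (length-tabulate {n = 6 + m} id)
    (Bound.edges-bound G free (toℕ ∘ pos) (pos-injective ∘ toℕ-injective) noncrossing _ (allFin⁺ (6 + m)) ≤-refl))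

-- Friendship graphs

deg-tabulate : ∀ {A : Set} (_~?_ : A → A → Bool) {n} x (f : Fin n → A) b → (∀ i → x ~? f i ≡ b) →
               Count.deg _~?_ x (tabulate f) ≡ n * [ b ]
deg-tabulate _~?_ {zero} x f b e = ≡-refl
deg-tabulate _~?_ {suc n} x f b e = cong₂ _+_ (cong [_] (e zero)) (deg-tabulate _~?_ x (f ∘ suc) b (e ∘ suc))

module _ {A B : Set} (_~?_ : A → A → Bool) (_≈?_ : B → B → Bool) where

  deg-tabulate-cong : ∀ {n} x y (f : Fin n → A) (g : Fin n → B) → (∀ i → x ~? f i ≡ y ≈? g i) →
                      Count.deg _~?_ x (tabulate f) ≡ Count.deg _≈?_ y (tabulate g)
  deg-tabulate-cong {zero} x y f g e = ≡-refl
  deg-tabulate-cong {suc n} x y f g e = cong₂ _+_ (cong [_] (e zero)) (deg-tabulate-cong x y (f ∘ suc) (g ∘ suc) (e ∘ suc))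

  edges-tabulate-cong : ∀ {n} (f : Fin n → A) (g : Fin n → B) → (∀ i j → f i ~? f j ≡ g i ≈? g j) →
                        Count.edges _~?_ (tabulate f) ≡ Count.edges _≈?_ (tabulate g)
  edges-tabulate-cong {zero} f g e = ≡-refl
  edges-tabulate-cong {suc n} f g e = cong₂ _+_ (deg-tabulate-cong (f zero) (g zero) (f ∘ suc) (g ∘ suc) (e zero ∘ suc))
                                                (edges-tabulate-cong (f ∘ suc) (g ∘ suc) (λ i j → e (suc i) (suc j)))

-- The matching 0-1, 2-3, and so on. The friendship graph is the cone over it, with a pendant last
-- vertex when the order is even.
mate : ℕ → ℕ → Bool
mate 0 1 = true
mate 1 0 = true
mate (suc (suc i)) (suc (suc j)) = mate i j
mate _ _ = false

friend : ℕ → ℕ → Bool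
friend 0 0 = false
friend 0 (suc _) = true
friend (suc _) 0 = true
friend (suc i) (suc j) = mate i j

mate-sym : ∀ i j → mate i j ≡ mate j i
mate-sym 0 0 = ≡-refl
mate-sym 0 1 = ≡-refl
mate-sym 0 (suc (suc _)) = ≡-refl
mate-sym 1 0 = ≡-refl
mate-sym 1 1 = ≡-refl
mate-sym 1 (suc (suc _)) = ≡-refl
mate-sym (suc (suc _)) 0 = ≡-refl
mate-sym (suc (suc _)) 1 = ≡-refl
mate-sym (suc (suc i)) (suc (suc j)) = mate-sym i j

mate-irrefl : ∀ i → mate i i ≡ false
mate-irrefl 0 = ≡-refl
mate-irrefl 1 = ≡-refl
mate-irrefl (suc (suc i)) = mate-irrefl i

mate-unique : ∀ i j k → mate i j ≡ true → mate i k ≡ true → j ≡ k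
mate-unique 0 1 1 _ _ = ≡-refl
mate-unique 1 0 0 _ _ = ≡-refl
mate-unique (suc (suc i)) (suc (suc j)) (suc (suc k)) p q = cong (2 +_) (mate-unique i j k p q)

mate-consecutive : ∀ i j → mate i j ≡ true → i < j → j ≡ suc i
mate-consecutive 0 1 _ _ = ≡-refl
mate-consecutive (suc (suc i)) (suc (suc j)) p (s≤s (s≤s i<j)) = cong (2 +_) (mate-consecutive i j p i<j)

friend-sym : ∀ i j → friend i j ≡ friend j i
friend-sym 0 0 = ≡-refl
friend-sym 0 (suc _) = ≡-refl
friend-sym (suc _) 0 = ≡-refl
friend-sym (suc i) (suc j) = mate-sym i j

friend-irrefl : ∀ i → friend i i ≡ false
friend-irrefl 0 = ≡-refl
friend-irrefl (suc i) = mate-irrefl i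

friend-deg≤2 : ∀ i p q r → friend (suc i) p ≡ true → friend (suc i) q ≡ true → friend (suc i) r ≡ true →
               p ≡ q ⊎ q ≡ r ⊎ p ≡ r
friend-deg≤2 i 0 0 _ _ _ _ = inj₁ ≡-refl
friend-deg≤2 i 0 (suc _) 0 _ _ _ = inj₂ (inj₂ ≡-refl)
friend-deg≤2 i (suc _) 0 0 _ _ _ = inj₂ (inj₁ ≡-refl)
friend-deg≤2 i (suc p) (suc q) _ a b _ = inj₁ (cong suc (mate-unique i p q a b))
friend-deg≤2 i 0 (suc q) (suc r) _ b c = inj₂ (inj₁ (cong suc (mate-unique i q r b c)))
friend-deg≤2 i (suc p) 0 (suc r) a _ c = inj₂ (inj₂ (cong suc (mate-unique i p r a c)))

friendship : ∀ n → Graph n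
friendship n = record
  { adj = λ u v → friend (toℕ u) (toℕ v)
  ; sym = λ u v → friend-sym (toℕ u) (toℕ v)
  ; irrefl = λ u → friend-irrefl (toℕ u) }

-- In numerical order the hub comes first, so in a crossing the edge starting later would join two
-- mates with a vertex strictly between them; but mates are consecutive.
friendship-outerplanar : ∀ n → Outerplanar (friendship n)
friendship-outerplanar n = id , id , λ u v w z → noncrossing (toℕ u) (toℕ v) (toℕ w) (toℕ z)
  where
  noncrossing : ∀ u v w z → friend u v ≡ true → friend w z ≡ true → u < w → w < v → v < z → ⊥
  noncrossing u v (suc w) (suc z) _ w~z u<w w<v v<z =
    <⇒≱ w<v (≤-trans (≤-pred v<z) (≤-reflexive (mate-consecutive w z w~z (≤-pred (<-trans w<v v<z)))))

-- Both centres of S₂,₂ have degree three, while every vertex except the hub has degree at most two.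
friendship-free : ∀ n → Free S22 (friendship n)
friendship-free n (f , f-injective , f-edge) with toℕ (f 0F) in e₀ | toℕ (f 1F) in e₁
... | zero | zero with f-injective (toℕ-injective (≡-trans e₀ (≡-sym e₁)))
...   | ()
friendship-free n (f , f-injective , f-edge) | suc i | _
  with friend-deg≤2 i _ _ _ (edge 1F ≡-refl) (edge 2F ≡-refl) (edge 3F ≡-refl)
  where
  edge : ∀ k → adj S22 0F k ≡ true → friend (suc i) (toℕ (f k)) ≡ true
  edge k e = subst (λ l → friend l (toℕ (f k)) ≡ true) e₀ (f-edge 0F k e)
... | inj₁ e with f-injective (toℕ-injective e)
...   | ()
friendship-free n (f , f-injective , f-edge) | suc i | _ | inj₂ (inj₁ e) with f-injective (toℕ-injective e)
... | ()
friendship-free n (f , f-injective , f-edge) | suc i | _ | inj₂ (inj₂ e) with f-injective (toℕ-injective e)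
... | ()
friendship-free n (f , f-injective , f-edge) | zero | suc i
  with friend-deg≤2 i _ _ _ (edge 0F ≡-refl) (edge 4F ≡-refl) (edge 5F ≡-refl)
  where
  edge : ∀ k → adj S22 1F k ≡ true → friend (suc i) (toℕ (f k)) ≡ true
  edge k e = subst (λ l → friend l (toℕ (f k)) ≡ true) e₁ (f-edge 1F k e)
... | inj₁ e with f-injective (toℕ-injective e)
...   | ()
friendship-free n (f , f-injective , f-edge) | zero | suc i | inj₂ (inj₁ e) with f-injective (toℕ-injective e)
... | ()
friendship-free n (f , f-injective , f-edge) | zero | suc i | inj₂ (inj₂ e) with f-injective (toℕ-injective e)
... | ()

mates : ∀ {m} → Fin m → Fin m → Bool
mates i j = mate (toℕ i) (toℕ j)

matching-edges : ∀ m → Count.edges (mates {m}) (allFin m) ≡ m / 2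
matching-edges 0 = ≡-refl
matching-edges 1 = ≡-refl
matching-edges (suc (suc m)) = begin
  1 + deg 0F rest + (deg 1F rest + edges rest)
    ≡⟨ cong₂ (λ k l → 1 + k + l) (isolated 0F λ _ → ≡-refl)
         (cong₂ _+_ (isolated 1F λ _ → ≡-refl) (edges-tabulate-cong mates mates suc² id (λ _ _ → ≡-refl))) ⟩
  suc (Count.edges (mates {m}) (allFin m)) ≡⟨ cong suc (matching-edges m) ⟩
  suc (m / 2)                              ≡⟨ m/n≡1+[m∸n]/n {suc (suc m)} {2} (s≤s (s≤s z≤n)) ⟨
  suc (suc m) / 2                          ∎
  where
  open ≡-Reasoning
  open Count (mates {suc (suc m)})
  suc² : Fin m → Fin (suc (suc m))
  suc² i = suc (suc i)
  rest : List (Fin (suc (suc m)))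
  rest = tabulate suc²
  isolated : ∀ x → (∀ i → mates x (suc (suc i)) ≡ false) → deg x rest ≡ 0
  isolated x e = ≡-trans (deg-tabulate mates x suc² false e) (*-zeroʳ m)

friendship-edges : ∀ m → edgeCount (friendship (suc m)) ≡ (3 * m) / 2
friendship-edges m = begin
  edgeCount (friendship (suc m)) ≡⟨ edgeCount≡edges (friendship (suc m)) ⟩
  Count.edges (adj (friendship (suc m))) (allFin (suc m))
    ≡⟨ cong₂ _+_ (deg-tabulate (adj (friendship (suc m))) 0F suc true (λ _ → ≡-refl))
         (≡-trans (edges-tabulate-cong (adj (friendship (suc m))) (mates {m}) suc id (λ _ _ → ≡-refl)) (matching-edges m)) ⟩
  -- The hub contributes `m` edges and the matching `m / 2`; writing `m` as `m * 2 / 2` lets the two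
  -- quotients be merged.
  m * 1 + m / 2                  ≡⟨ cong (_+ m / 2) (≡-trans (*-identityʳ m) (≡-sym (m*n/n≡m m 2))) ⟩
  m * 2 / 2 + m / 2              ≡⟨ +-distrib-/-∣ˡ m (n∣m*n m {2}) ⟨
  (m * 2 + m) / 2                ≡⟨ cong (_/ 2) (triple m) ⟩
  (3 * m) / 2                    ∎
  where
  open ≡-Reasoning
  triple : ∀ m → m * 2 + m ≡ 3 * m
  triple = solve-∀

-- Two disjoint fans on ten vertices

fanAdj : ℕ → ℕ → Bool
fanAdj 0 0 = false
fanAdj 0 (suc _) = true
fanAdj (suc _) 0 = true
fanAdj (suc i) (suc j) = if i <ᵇ j then suc i ≡ᵇ j else suc j ≡ᵇ i

twoFans : Graph 10
twoFans = record
  { adj = fans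
  ; sym = from-yes (all? λ u → all? λ v → fans u v ≟ᵇ fans v u)
  ; irrefl = from-yes (all? λ u → fans u u ≟ᵇ false) }
  where
  fans : Fin 10 → Fin 10 → Bool
  fans u v = (toℕ u / 5 ≡ᵇ toℕ v / 5) ∧ fanAdj (toℕ u % 5) (toℕ v % 5)

twoFans-outerplanar : Outerplanar twoFans
twoFans-outerplanar = id , id , λ u v w z u~v w~z u<w w<v v<z → noncrossing u v u~v w z w~z (u<w , w<v , v<z)
  where
  noncrossing : ∀ u v → adj twoFans u v ≡ true → ∀ w z → adj twoFans w z ≡ true →
                ¬ (toℕ u < toℕ w × toℕ w < toℕ v × toℕ v < toℕ z)
  noncrossing = from-yes (all? λ u → all? λ v → (adj twoFans u v ≟ᵇ true) →-dec
    (all? λ w → all? λ z → (adj twoFans w z ≟ᵇ true) →-dec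
    ¬? ((toℕ u <? toℕ w) ×-dec (toℕ w <? toℕ v) ×-dec (toℕ v <? toℕ z))))

-- S₂,₂ is connected, so its six vertices would all land in one block of five, and two of them would
-- share a residue modulo 5.
twoFans-free : Free S22 twoFans
twoFans-free (f , f-injective , f-edge) with pigeonhole (n<1+n 5) (λ k → fromℕ< (m%n<n (toℕ (f k)) 5))
... | i , j , i<j , e = <⇒≢ᶠ i<j (f-injective (toℕ-injective (begin
  toℕ (f i)                   ≡⟨ m≡m%n+[m/n]*n (toℕ (f i)) 5 ⟩
  toℕ (f i) % 5 + block i * 5 ≡⟨ cong₂ (λ r q → r + q * 5) rem (≡-trans (same-block i) (≡-sym (same-block j))) ⟩
  toℕ (f j) % 5 + block j * 5 ≡⟨ m≡m%n+[m/n]*n (toℕ (f j)) 5 ⟨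
  toℕ (f j)                   ∎)))
  where
  open ≡-Reasoning
  rem : toℕ (f i) % 5 ≡ toℕ (f j) % 5
  rem = ≡-trans (≡-sym (toℕ-fromℕ< _)) (≡-trans (cong toℕ e) (toℕ-fromℕ< _))
  block : Fin 6 → ℕ
  block k = toℕ (f k) / 5
  adjacent-block : ∀ u v → adj twoFans u v ≡ true → toℕ v / 5 ≡ toℕ u / 5
  adjacent-block = from-yes (all? λ u → all? λ v → (adj twoFans u v ≟ᵇ true) →-dec (toℕ v / 5 ≟ toℕ u / 5))
  edge-block : ∀ k l → adj S22 k l ≡ true → block l ≡ block k
  edge-block k l k~l = adjacent-block (f k) (f l) (f-edge k l k~l)
  same-block : ∀ k → block k ≡ block 0F
  same-block 0F = ≡-refl
  same-block 1F = edge-block 0F 1F ≡-refl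
  same-block 2F = edge-block 0F 2F ≡-refl
  same-block 3F = edge-block 0F 3F ≡-refl
  same-block 4F = ≡-trans (edge-block 1F 4F ≡-refl) (same-block 1F)
  same-block 5F = ≡-trans (edge-block 1F 5F ≡-refl) (same-block 1F)

lower-bound : ∀ n → Σ (Graph (suc n)) λ G → OPFree S22 (suc n) G × edgeCount G ≡ exS22 (suc n)
lower-bound n with n ≡ᵇ 9 in e
... | false = friendship (suc n) , (friendship-outerplanar (suc n) , friendship-free (suc n)) , friendship-edges n
... | true with ≡ᵇ⇒≡ n 9 (subst T (≡-sym e) _)
...   | ≡-refl = twoFans , (twoFans-outerplanar , twoFans-free) , ≡-refl

theorem3 : ∀ (n : ℕ) → n ≥ 6 → ExOPIs n S22 (exS22 n)
theorem3 (suc (suc (suc (suc (suc (suc m)))))) (s≤s (s≤s (s≤s (s≤s (s≤s (s≤s _)))))) =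
  lower-bound (5 + m) , upper-bound m
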